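{- For every $\varepsilon > 0$ there exist a constant $c > 0$ and an integer $k_0$ such that the following holds. Let $k \ge k_0$ be an integer and let $G$ be an $n$-vertex finite graph with minimum degree at least $k$. If $p \in [0,1]$ satisfies $p \ge \frac{1+\varepsilon}{k}$, then $\mathbb{E}[\mathrm{exc}(G_p)] \ge cn$.
   Context: For a graph $G$, $e(G)$ is its number of edges, and the number of excess edges is $\mathrm{exc}(G) = e(G) - |V(G)| + (\text{number of connected components of } G)$. For a graph $G$ and $p \in [0,1]$, $G_p$ is the random spanning subgraph of $G$ obtained by keeping each edge of $G$ independently with probability $p$.
   Formalization: The formal theorem takes ε, c and the probability p to be rational numbers instead of real numbers. -}

module Defs where

open import Data.Nat as ℕ using (ℕ; zero; suc)
open import Data.Bool using (Bool; true; false; _∧_; _∨_; not; if_then_else_)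
open import Data.Fin using (Fin; toℕ; _<?_)
open import Data.Fin.Properties using (_≟_)
open import Data.List as List using (List; []; _∷_; length; filter; allFin; concatMap; map; foldr)
open import Data.Bool.ListAction using (any; all)
open import Data.Product using (_×_; _,_; proj₁; proj₂)
open import Data.Rational as ℚ using (ℚ; 0ℚ; 1ℚ; _+_; _*_; _-_)
open import Data.Integer as ℤ using (ℤ)
open import Relation.Binary.PropositionalEquality using (_≡_)
open import Relation.Nullary.Decidable using (⌊_⌋)

record Graph (n : ℕ) : Set where
  field
    adj    : Fin n → Fin n → Bool
    sym    : ∀ i j → adj i j ≡ adj j i
    irrefl : ∀ i → adj i i ≡ false
open Graph public

-- Edge set of G: each edge {i,j} listed once, as the pair (i , j) with i < j.
Edge : ℕ → Set
Edge n = Fin n × Fin n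

edges : ∀ {n} → Graph n → List (Edge n)
edges {n} G =
  concatMap (λ i → map (λ j → (i , j))
                       (filter (λ j → (⌊ i <? j ⌋ ∧ adj G i j) Data.Bool.≟ true) (allFin n)))
            (allFin n)
  where import Data.Bool

count : ∀ {n} → (Fin n → Bool) → ℕ
count {n} f = length (List.filter (λ i → f i Data.Bool.≟ true) (allFin n))
  where import Data.Bool

deg : ∀ {n} → Graph n → Fin n → ℕ
deg G i = count (adj G i)

MinDegreeAtLeast : ∀ {n} → Graph n → ℕ → Set
MinDegreeAtLeast {n} G k = ∀ (i : Fin n) → k ℕ.≤ deg G i

-- Spanning subgraphs of G correspond to subsets (sublists) of its edge list.
sublists : ∀ {A : Set} → List A → List (List A)
sublists []       = [] ∷ []
sublists (x ∷ xs) = let r = sublists xs in r List.++ map (x ∷_) r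

adjacentIn : ∀ {n} → List (Edge n) → Fin n → Fin n → Bool
adjacentIn es u v =
  any (λ e → (⌊ proj₁ e ≟ u ⌋ ∧ ⌊ proj₂ e ≟ v ⌋) ∨ (⌊ proj₁ e ≟ v ⌋ ∧ ⌊ proj₂ e ≟ u ⌋)) es

step : ∀ {n} → List (Edge n) → (Fin n → Bool) → (Fin n → Bool)
step {n} es R v = R v ∨ any (λ u → R u ∧ adjacentIn es u v) (allFin n)

iter : ∀ {A : Set} → ℕ → (A → A) → A → A
iter zero    f x = x
iter (suc t) f x = f (iter t f x)

-- reachable es v u : u lies in the connected component of v
-- (n closure steps suffice on n vertices)
reachable : ∀ {n} → List (Edge n) → Fin n → Fin n → Bool
reachable {n} es v = iter n (step es) (λ u → ⌊ u ≟ v ⌋)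

-- number of connected components: count the vertices that are the least
-- vertex of their component
components : ∀ {n} → List (Edge n) → ℕ
components {n} es =
  count (λ v → all (λ u → not (⌊ u <? v ⌋ ∧ reachable es v u)) (allFin n))

ℕtoℚ : ℕ → ℚ
ℕtoℚ m = (ℤ.+ m) ℚ./ 1

exc : ∀ {n} → List (Edge n) → ℚ
exc {n} es = (ℕtoℚ (length es) - ℕtoℚ n) + ℕtoℚ (components es)

pow : ℚ → ℕ → ℚ
pow q zero    = 1ℚ
pow q (suc m) = q * pow q m

expectedExc : ∀ {n} → Graph n → ℚ → ℚ
expectedExc G p =
  foldr _+_ 0ℚ
    (map (λ S → (pow p (length S) * pow (1ℚ - p) (length (edges G) ℕ.∸ length S)) * exc S)
         (sublists (edges G)))

{-# OPTIONS --safe #-}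

-- Expose the edges in two rounds, of densities p₁ = (1 + ε/2) / k and about (ε/2) / k.
-- In the first round, exploring the component of a vertex dominates a supercritical
-- branching process until M vertices are found, so every vertex lies in a component of
-- size ≥ M with probability ≥ δ(ε), where δ does not depend on M. By Harris' inequality
-- both ends of an edge do so with probability ≥ δ². There are at most n / M components
-- of size ≥ M, hence all but n / M of the second-round edges between them close a
-- cycle, and about (ε/2k) (kn/2) δ² such edges are expected. Take M large.

module Submission where

open import Defs
open import Data.Bool using (true; false; T; _∧_; _∨_; not)
import Data.Bool.Properties as Bool
open import Data.Empty using (⊥)
open import Data.Fin using (Fin; zero; _<?_) renaming (_<_ to _<ᶠ_)
import Data.Fin.Induction as Fin
import Data.Fin.Properties as Fin
import Data.Integer as ℤ
import Data.Integer.Properties as ℤ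
open import Data.List using (List; []; _∷_; _++_; [_]; map; length; foldr; filter; allFin; concatMap)
import Data.List.Membership.DecPropositional as DecMembership
open import Data.List.Membership.Propositional using (_∈_; _∉_; find; lose)
open import Data.List.Membership.Propositional.Properties
import Data.List.Properties as List
open import Data.List.Relation.Binary.Permutation.Propositional
  using (_↭_; prep; swap; refl; ↭-trans; ↭-sym; ↭-refl; ↭-reflexive; module _↭_)
open import Data.List.Relation.Binary.Permutation.Propositional.Properties using (shift; ∈-resp-↭; ↭-length)
import Data.List.Relation.Binary.Permutation.Propositional.Properties as ↭
open import Data.List.Relation.Binary.Sublist.Propositional using ([]; _∷_; _∷ʳ_) renaming (_⊆_ to Sublist)
import Data.List.Relation.Binary.Sublist.Propositional.Properties as Sublist
open import Data.List.Relation.Binary.Subset.Propositional using (_⊆_)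
import Data.List.Relation.Binary.Subset.Propositional.Properties as ⊆
open import Data.List.Relation.Unary.All using (All; []; _∷_)
import Data.List.Relation.Unary.All as All
import Data.List.Relation.Unary.All.Properties as All
open import Data.List.Relation.Unary.AllPairs using ([]; _∷_)
open import Data.List.Relation.Unary.Any using (Any; here; there)
import Data.List.Relation.Unary.Any as Any
import Data.List.Relation.Unary.Any.Properties as Any
open import Data.List.Relation.Unary.Unique.Propositional using (Unique)
import Data.List.Relation.Unary.Unique.Propositional.Properties as Unique
open import Data.Nat as ℕ using (ℕ; zero; suc)
open import Data.Nat.Coprimality using (1-coprimeTo)
import Data.Nat.Coprimality as Coprimality
import Data.Nat.Properties as ℕ
import Data.Nat.Solver as ℕ
open import Data.Product using (∃; ∃-syntax; _×_; _,_; proj₁; proj₂)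
import Data.Product as Product
open import Data.Rational
  using (ℚ; mkℚ; 0ℚ; 1ℚ; ½; _+_; _*_; _-_; -_; 1/_; _≤_; _<_; *≤*; *<*; Positive; positive; nonNegative; toℚᵘ; fromℚᵘ)
open import Data.Rational.Properties as ℚ using (≤-refl; ≤-trans; ≤-reflexive; ≤-antisym; module ≤-Reasoning)
open import Data.Rational.Solver using (module +-*-Solver)
open import Data.Rational.Unnormalised as ℚᵘ using (mkℚᵘ; *≡*)
import Data.Rational.Unnormalised.Properties as ℚᵘ
open import Data.Sum using (_⊎_; inj₁; inj₂; [_,_]′)
open import Function using (_∘_; id; Equivalence)
open import Induction.WellFounded using (Acc; acc)
open import Relation.Binary using (tri<; tri≈; tri>)
open import Relation.Binary.PropositionalEquality
  using (_≡_; _≢_; refl; trans; cong; cong₂; subst; subst₂; module ≡-Reasoning)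
import Relation.Binary.PropositionalEquality as ≡
open import Relation.Nullary using (Dec; yes; no; ¬_; ¬?; contradiction; _×-dec_; _⊎-dec_)
open import Relation.Nullary.Decidable using (⌊_⌋; toWitness; decidable-stable)
open import Relation.Unary using (Decidable)

-- Rational arithmetic

-- The order of choices matters: `k₀` may depend on `M`, while the probability `δ` of lying in a big
-- component does not, so `M` can be fixed after `δ`. With `L ≥ k n / 2` edges the second round
-- closes on average at least `(4δ/k) (δ²/2) L ≥ δ³ n` edges inside the union of the big components
-- and pays at most `n / M`. This dictates `M = 2/δ³` and `c = 1/M`. Two obstacles shape the proof.
-- The second round draws only from edges missed by the first, and missing an edge is not
-- independent of its ends being big. The dependence is bounded crudely: all first-round edges are
-- subtracted, `p₁ L` on average, and `p₁ ≤ δ²/2` once `k` is large. Secondly, an explored vertex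
-- shares neighbours with earlier ones. While fewer than `M` vertices have been found, at least
-- `k - M` neighbours are fresh, and `M/k ≤ δ` keeps the process supercritical. For `p` well above
-- `(1 + ε)/k` the first round is unchanged and the second takes the whole surplus, which only
-- improves the bound.

0≤1 : 0ℚ ≤ 1ℚ
0≤1 = ℚ.nonNegative⁻¹ 1ℚ

0≤+ : ∀ {x y} → 0ℚ ≤ x → 0ℚ ≤ y → 0ℚ ≤ x + y
0≤+ = ℚ.+-mono-≤

0≤* : ∀ {x y} → 0ℚ ≤ x → 0ℚ ≤ y → 0ℚ ≤ x * y
0≤* {x} {y} a b = ℚ.nonNegative⁻¹ (x * y) {{ℚ.nonNeg*nonNeg⇒nonNeg x {{nonNegative a}} y {{nonNegative b}}}}

≤⇒0≤- : ∀ {x y} → x ≤ y → 0ℚ ≤ y - x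
≤⇒0≤- {x} {y} x≤y = ≤-trans (≤-reflexive (≡.sym (ℚ.+-inverseʳ x))) (ℚ.+-monoˡ-≤ (- x) x≤y)

≤-by-gap : ∀ {x y} d → 0ℚ ≤ d → y ≡ x + d → x ≤ y
≤-by-gap {x} d 0≤d eq = ≤-trans (≤-reflexive (≡.sym (ℚ.+-identityʳ x)))
  (≤-trans (ℚ.+-monoʳ-≤ x 0≤d) (≤-reflexive (≡.sym eq)))

*-monoˡ : ∀ {r x y} → 0ℚ ≤ r → x ≤ y → r * x ≤ r * y
*-monoˡ {r} 0≤r = ℚ.*-monoˡ-≤-nonNeg r {{nonNegative 0≤r}}

*-monoʳ : ∀ {r x y} → 0ℚ ≤ r → x ≤ y → x * r ≤ y * r
*-monoʳ {r} 0≤r = ℚ.*-monoʳ-≤-nonNeg r {{nonNegative 0≤r}}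

*-mono : ∀ {x y z w} → 0ℚ ≤ x → 0ℚ ≤ w → x ≤ y → z ≤ w → x * z ≤ y * w
*-mono 0≤x 0≤w x≤y z≤w = ≤-trans (*-monoˡ 0≤x z≤w) (*-monoʳ 0≤w x≤y)

-- `ℕtoℚ` normalises through a gcd, which does not compute on a variable, so the identity is checked
-- in the unnormalised rationals.
ℕtoℚ-suc : ∀ m → ℕtoℚ (suc m) ≡ 1ℚ + ℕtoℚ m
ℕtoℚ-suc m = ℚ.toℚᵘ-injective (begin
  toℚᵘ (fromℚᵘ (mkℚᵘ (ℤ.+ suc m) 0))        ≈⟨ ℚ.toℚᵘ-fromℚᵘ _ ⟩
  mkℚᵘ (ℤ.+ suc m) 0                        ≈⟨ *≡* (cong (ℤ._* ℤ.1ℤ) eq) ⟩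
  toℚᵘ 1ℚ ℚᵘ.+ mkℚᵘ (ℤ.+ m) 0               ≈⟨ ℚᵘ.+-congʳ (toℚᵘ 1ℚ) (ℚ.toℚᵘ-fromℚᵘ (mkℚᵘ (ℤ.+ m) 0)) ⟨
  toℚᵘ 1ℚ ℚᵘ.+ toℚᵘ (ℕtoℚ m)                ≈⟨ ℚ.toℚᵘ-homo-+ 1ℚ (ℕtoℚ m) ⟨
  toℚᵘ (1ℚ + ℕtoℚ m)                        ∎)
  where
  open ℚᵘ.≃-Reasoning
  eq : ℤ.+ suc m ≡ ℤ.+ 1 ℤ.+ ℤ.+ m ℤ.* ℤ.1ℤ
  eq = cong (ℤ._+_ ℤ.1ℤ) (≡.sym (ℤ.*-identityʳ (ℤ.+ m)))

ℕtoℚ-+ : ∀ a b → ℕtoℚ (a ℕ.+ b) ≡ ℕtoℚ a + ℕtoℚ b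
ℕtoℚ-+ zero    b = ≡.sym (ℚ.+-identityˡ (ℕtoℚ b))
ℕtoℚ-+ (suc a) b = begin
  ℕtoℚ (suc (a ℕ.+ b))       ≡⟨ ℕtoℚ-suc (a ℕ.+ b) ⟩
  1ℚ + ℕtoℚ (a ℕ.+ b)        ≡⟨ cong (1ℚ +_) (ℕtoℚ-+ a b) ⟩
  1ℚ + (ℕtoℚ a + ℕtoℚ b)     ≡⟨ ℚ.+-assoc 1ℚ (ℕtoℚ a) (ℕtoℚ b) ⟨
  1ℚ + ℕtoℚ a + ℕtoℚ b       ≡⟨ cong (_+ ℕtoℚ b) (ℕtoℚ-suc a) ⟨
  ℕtoℚ (suc a) + ℕtoℚ b      ∎
  where open ≡-Reasoning

ℕtoℚ-* : ∀ a b → ℕtoℚ (a ℕ.* b) ≡ ℕtoℚ a * ℕtoℚ b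
ℕtoℚ-* zero    b = ≡.sym (ℚ.*-zeroˡ (ℕtoℚ b))
ℕtoℚ-* (suc a) b = begin
  ℕtoℚ (b ℕ.+ a ℕ.* b)           ≡⟨ ℕtoℚ-+ b (a ℕ.* b) ⟩
  ℕtoℚ b + ℕtoℚ (a ℕ.* b)        ≡⟨ cong (ℕtoℚ b +_) (ℕtoℚ-* a b) ⟩
  ℕtoℚ b + ℕtoℚ a * ℕtoℚ b       ≡⟨ cong (_+ ℕtoℚ a * ℕtoℚ b) (ℚ.*-identityˡ (ℕtoℚ b)) ⟨
  1ℚ * ℕtoℚ b + ℕtoℚ a * ℕtoℚ b  ≡⟨ ℚ.*-distribʳ-+ (ℕtoℚ b) 1ℚ (ℕtoℚ a) ⟨
  (1ℚ + ℕtoℚ a) * ℕtoℚ b         ≡⟨ cong (_* ℕtoℚ b) (ℕtoℚ-suc a) ⟨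
  ℕtoℚ (suc a) * ℕtoℚ b          ∎
  where open ≡-Reasoning

0≤ℕtoℚ : ∀ m → 0ℚ ≤ ℕtoℚ m
0≤ℕtoℚ zero    = ≤-refl
0≤ℕtoℚ (suc m) = ≤-trans (0≤+ 0≤1 (0≤ℕtoℚ m)) (≤-reflexive (≡.sym (ℕtoℚ-suc m)))

ℕtoℚ-mono : ∀ {a b} → a ℕ.≤ b → ℕtoℚ a ≤ ℕtoℚ b
ℕtoℚ-mono {a} {b} a≤b = ≤-by-gap (ℕtoℚ (b ℕ.∸ a)) (0≤ℕtoℚ (b ℕ.∸ a))
  (trans (cong ℕtoℚ (≡.sym (ℕ.m+[n∸m]≡n a≤b))) (ℕtoℚ-+ a (b ℕ.∸ a)))

pow-+ : ∀ r a b → pow r (a ℕ.+ b) ≡ pow r a * pow r b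
pow-+ r zero    b = ≡.sym (ℚ.*-identityˡ (pow r b))
pow-+ r (suc a) b = trans (cong (r *_) (pow-+ r a b)) (≡.sym (ℚ.*-assoc r (pow r a) (pow r b)))

module _ {r} (0≤r : 0ℚ ≤ r) where

  0≤pow : ∀ a → 0ℚ ≤ pow r a
  0≤pow zero    = 0≤1
  0≤pow (suc a) = 0≤* 0≤r (0≤pow a)

  pow≤1 : r ≤ 1ℚ → ∀ a → pow r a ≤ 1ℚ
  pow≤1 r≤1 zero    = ≤-refl
  pow≤1 r≤1 (suc a) = ≤-trans (*-mono 0≤r 0≤1 r≤1 (pow≤1 r≤1 a)) (≤-reflexive (ℚ.*-identityˡ 1ℚ))

  pow-antitone : r ≤ 1ℚ → ∀ {a b} → a ℕ.≤ b → pow r b ≤ pow r a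
  pow-antitone r≤1 {a} {b} a≤b = begin
    pow r b                     ≡⟨ cong (pow r) (ℕ.m+[n∸m]≡n a≤b) ⟨
    pow r (a ℕ.+ (b ℕ.∸ a))     ≡⟨ pow-+ r a (b ℕ.∸ a) ⟩
    pow r a * pow r (b ℕ.∸ a)   ≤⟨ *-monoˡ (0≤pow a) (pow≤1 r≤1 (b ℕ.∸ a)) ⟩
    pow r a * 1ℚ                ≡⟨ ℚ.*-identityʳ (pow r a) ⟩
    pow r a                     ∎
    where open ≤-Reasoning

-- Read as (1 - x) ^ m ≤ 1 / (1 + m x): unlike a Taylor bound, it needs no upper bound on m x.
pow-1-x : ∀ {x} → 0ℚ ≤ x → x ≤ 1ℚ → ∀ m → pow (1ℚ - x) m * (1ℚ + ℕtoℚ m * x) ≤ 1ℚ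
pow-1-x {x} 0≤x x≤1 zero = ≤-reflexive (solve 1 (λ x → con 1ℚ :* (con 1ℚ :+ con 0ℚ :* x) := con 1ℚ) refl x)
  where open +-*-Solver
pow-1-x {x} 0≤x x≤1 (suc m) = begin
  (1ℚ - x) * P * (1ℚ + ℕtoℚ (suc m) * x)   ≡⟨ cong (λ t → (1ℚ - x) * P * (1ℚ + t * x)) (ℕtoℚ-suc m) ⟩
  (1ℚ - x) * P * (1ℚ + (1ℚ + N) * x)       ≤⟨ ≤-by-gap (P * ((1ℚ + N) * (x * x))) (0≤* (0≤pow 0≤1-x m) (0≤* (0≤+ 0≤1 (0≤ℕtoℚ m)) (0≤* 0≤x 0≤x))) (eq x P N) ⟩
  P * (1ℚ + N * x)                         ≤⟨ pow-1-x 0≤x x≤1 m ⟩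
  1ℚ                                       ∎
  where
  open ≤-Reasoning
  P = pow (1ℚ - x) m
  N = ℕtoℚ m
  0≤1-x : 0ℚ ≤ 1ℚ - x
  0≤1-x = ≤⇒0≤- x≤1
  eq : ∀ x P N → P * (1ℚ + N * x) ≡ (1ℚ - x) * P * (1ℚ + (1ℚ + N) * x) + P * ((1ℚ + N) * (x * x))
  eq = solve 3 (λ x P N → P :* (con 1ℚ :+ N :* x) := (con 1ℚ :- x) :* P :* (con 1ℚ :+ (con 1ℚ :+ N) :* x) :+ P :* ((con 1ℚ :+ N) :* (x :* x))) refl
    where open +-*-Solver

ind : ∀ {a} {P : Set a} → Dec P → ℚ
ind (yes _) = 1ℚ
ind (no  _) = 0ℚ

0≤ind : ∀ {a} {P : Set a} (P? : Dec P) → 0ℚ ≤ ind P?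
0≤ind (yes _) = 0≤1
0≤ind (no  _) = ≤-refl

ind≤1 : ∀ {a} {P : Set a} (P? : Dec P) → ind P? ≤ 1ℚ
ind≤1 (yes _) = ≤-refl
ind≤1 (no  _) = 0≤1

ind-mono : ∀ {a b} {P : Set a} {Q : Set b} (P? : Dec P) (Q? : Dec Q) → (P → Q) → ind P? ≤ ind Q?
ind-mono (yes p) (yes q) f = ≤-refl
ind-mono (yes p) (no ¬q) f = contradiction (f p) ¬q
ind-mono (no ¬p) Q?      f = 0≤ind Q?

ind-false : ∀ {a} {P : Set a} (P? : Dec P) → ¬ P → ind P? ≡ 0ℚ
ind-false (yes p) ¬p = contradiction p ¬p
ind-false (no _)  ¬p = refl

ind-true : ∀ {a} {P : Set a} (P? : Dec P) → P → ind P? ≡ 1ℚ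
ind-true (yes p) _ = refl
ind-true (no ¬p) p = contradiction p ¬p

-- Random subsets of a list

module _ {A : Set} where

  -- The order is inclusion of members, blind to position and multiplicity. An antitone function is
  -- therefore permutation-invariant at once.
  Isotone Antitone ↭-Invariant : (List A → ℚ) → Set
  Isotone     f = ∀ {S T} → S ⊆ T → f S ≤ f T
  Antitone    f = ∀ {S T} → S ⊆ T → f T ≤ f S
  ↭-Invariant f = ∀ {S T} → S ↭ T → f S ≡ f T

  antitone⇒invariant : ∀ {f} → Antitone f → ↭-Invariant f
  antitone⇒invariant anti S↭T = ≤-antisym (anti (∈-resp-↭ (↭-sym S↭T))) (anti (∈-resp-↭ S↭T))

  𝔼 : ℚ → List A → (List A → ℚ) → ℚ
  𝔼 p []       f = f []
  𝔼 p (x ∷ xs) f = (1ℚ - p) * 𝔼 p xs f + p * 𝔼 p xs (f ∘ (x ∷_))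

  -- The second argument of the random variable lists the elements left out.
  𝔼₂ : ℚ → List A → (List A → List A → ℚ) → ℚ
  𝔼₂ p []       f = f [] []
  𝔼₂ p (x ∷ xs) f = (1ℚ - p) * 𝔼₂ p xs (λ S U → f S (x ∷ U)) + p * 𝔼₂ p xs (λ S U → f (x ∷ S) U)

  ∑ : List A → (A → ℚ) → ℚ
  ∑ []       h = 0ℚ
  ∑ (x ∷ xs) h = h x + ∑ xs h

  ∑-++ : ∀ xs ys h → ∑ (xs ++ ys) h ≡ ∑ xs h + ∑ ys h
  ∑-++ []       ys h = ≡.sym (ℚ.+-identityˡ (∑ ys h))
  ∑-++ (x ∷ xs) ys h = trans (cong (h x +_) (∑-++ xs ys h)) (≡.sym (ℚ.+-assoc (h x) (∑ xs h) (∑ ys h)))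

  ∑-↭ : ∀ {xs ys} h → xs ↭ ys → ∑ xs h ≡ ∑ ys h
  ∑-↭ h refl = refl
  ∑-↭ h (prep x xs↭ys) = cong (h x +_) (∑-↭ h xs↭ys)
  ∑-↭ {_ ∷ _ ∷ xs} {_ ∷ _ ∷ ys} h (swap x y xs↭ys) = trans (cong (λ s → h x + (h y + s)) (∑-↭ h xs↭ys)) (eq (h x) (h y) (∑ ys h))
    where
    open +-*-Solver
    eq : ∀ a b s → a + (b + s) ≡ b + (a + s)
    eq = solve 3 (λ a b s → a :+ (b :+ s) := b :+ (a :+ s)) refl
  ∑-↭ h (_↭_.trans xs↭ys ys↭zs) = trans (∑-↭ h xs↭ys) (∑-↭ h ys↭zs)

  ∑-mono : ∀ xs {g h : A → ℚ} → (∀ x → g x ≤ h x) → ∑ xs g ≤ ∑ xs h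
  ∑-mono []       g≤h = ≤-refl
  ∑-mono (x ∷ xs) g≤h = ℚ.+-mono-≤ (g≤h x) (∑-mono xs g≤h)

  ∑-const : ∀ xs c → ∑ xs (λ _ → c) ≡ ℕtoℚ (length xs) * c
  ∑-const []       c = ≡.sym (ℚ.*-zeroˡ c)
  ∑-const (x ∷ xs) c = begin
    c + ∑ xs (λ _ → c)            ≡⟨ cong (c +_) (∑-const xs c) ⟩
    c + ℕtoℚ (length xs) * c      ≡⟨ eq (ℕtoℚ (length xs)) c ⟩
    (1ℚ + ℕtoℚ (length xs)) * c   ≡⟨ cong (_* c) (ℕtoℚ-suc (length xs)) ⟨
    ℕtoℚ (suc (length xs)) * c    ∎
    where
    open ≡-Reasoning
    eq : ∀ l c → c + l * c ≡ (1ℚ + l) * c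
    eq = solve 2 (λ l c → c :+ l :* c := (con 1ℚ :+ l) :* c) refl
      where open +-*-Solver

  -- `expectedExc G p` unfolds to `weightedSum p (edges G) exc`. Everything else is done with the
  -- recursive `𝔼`, which conditions on one element at a time.
  weightedSum : ℚ → List A → (List A → ℚ) → ℚ
  weightedSum p xs f = foldr _+_ 0ℚ
    (map (λ S → (pow p (length S) * pow (1ℚ - p) (length xs ℕ.∸ length S)) * f S) (sublists xs))

  sumOf : (List A → ℚ) → List (List A) → ℚ
  sumOf g Ss = foldr _+_ 0ℚ (map g Ss)

  sumOf-++ : ∀ g Ss Ts → sumOf g (Ss ++ Ts) ≡ sumOf g Ss + sumOf g Ts
  sumOf-++ g []       Ts = ≡.sym (ℚ.+-identityˡ (sumOf g Ts))
  sumOf-++ g (S ∷ Ss) Ts = trans (cong (g S +_) (sumOf-++ g Ss Ts)) (≡.sym (ℚ.+-assoc (g S) (sumOf g Ss) (sumOf g Ts)))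

  sumOf-scale : ∀ (P : List A → Set) c g h → (∀ S → P S → g S ≡ c * h S) → ∀ {Ss} → All P Ss → sumOf g Ss ≡ c * sumOf h Ss
  sumOf-scale P c g h g≡ch []                    = ≡.sym (ℚ.*-zeroʳ c)
  sumOf-scale P c g h g≡ch {S ∷ Ss} (pS ∷ pSs) =
    trans (cong₂ _+_ (g≡ch S pS) (sumOf-scale P c g h g≡ch pSs)) (≡.sym (ℚ.*-distribˡ-+ c (h S) (sumOf h Ss)))

  -- Guards the truncated subtraction in the weights: a factor `1ℚ - p` comes out of the exponent
  -- `suc (length xs) ∸ length S` only when `S` is no longer than `xs`.
  length-sublists : ∀ (xs : List A) → All (λ S → length S ℕ.≤ length xs) (sublists xs)
  length-sublists []       = ℕ.z≤n ∷ []
  length-sublists (x ∷ xs) = All.++⁺ (All.map ℕ.m≤n⇒m≤1+n (length-sublists xs))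
    (All.map⁺ (All.map ℕ.s≤s (length-sublists xs)))

  weightedSum≡𝔼 : ∀ p xs f → weightedSum p xs f ≡ 𝔼 p xs f
  weightedSum≡𝔼 p []       f = solve 1 (λ x → con 1ℚ :* con 1ℚ :* x :+ con 0ℚ := x) refl (f [])
    where open +-*-Solver
  weightedSum≡𝔼 p (x ∷ xs) f = begin
    sumOf g (sublists xs ++ map (x ∷_) (sublists xs))
      ≡⟨ sumOf-++ g (sublists xs) (map (x ∷_) (sublists xs)) ⟩
    sumOf g (sublists xs) + sumOf g (map (x ∷_) (sublists xs))
      ≡⟨ cong (λ l → sumOf g (sublists xs) + foldr _+_ 0ℚ l) (List.map-∘ (sublists xs)) ⟨
    sumOf g (sublists xs) + sumOf (g ∘ (x ∷_)) (sublists xs)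
      ≡⟨ cong₂ _+_ (sumOf-scale Short (1ℚ - p) g (w f) out (length-sublists xs))
                   (sumOf-scale Short p (g ∘ (x ∷_)) (w (f ∘ (x ∷_))) (λ S _ → eq₂ p (pow p (length S)) (pow (1ℚ - p) (length xs ℕ.∸ length S)) (f (x ∷ S)))
                                (length-sublists xs)) ⟩
    (1ℚ - p) * weightedSum p xs f + p * weightedSum p xs (f ∘ (x ∷_))
      ≡⟨ cong₂ (λ a b → (1ℚ - p) * a + p * b) (weightedSum≡𝔼 p xs f) (weightedSum≡𝔼 p xs (f ∘ (x ∷_))) ⟩
    (1ℚ - p) * 𝔼 p xs f + p * 𝔼 p xs (f ∘ (x ∷_)) ∎
    where
    open ≡-Reasoning
    g : List A → ℚ
    g S = (pow p (length S) * pow (1ℚ - p) (suc (length xs) ℕ.∸ length S)) * f S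
    Short : List A → Set
    Short S = length S ℕ.≤ length xs
    w : (List A → ℚ) → List A → ℚ
    w f S = (pow p (length S) * pow (1ℚ - p) (length xs ℕ.∸ length S)) * f S
    eq₁ : ∀ a q b c → a * (q * b) * c ≡ q * (a * b * c)
    eq₁ = solve 4 (λ a q b c → a :* (q :* b) :* c := q :* (a :* b :* c)) refl
      where open +-*-Solver
    out : ∀ S → Short S → g S ≡ (1ℚ - p) * w f S
    out S S≤ = trans (cong (λ e → pow p (length S) * pow (1ℚ - p) e * f S) (ℕ.+-∸-assoc 1 S≤))
      (eq₁ (pow p (length S)) (1ℚ - p) (pow (1ℚ - p) (length xs ℕ.∸ length S)) (f S))
    eq₂ : ∀ p a b c → p * a * b * c ≡ p * (a * b * c)
    eq₂ = solve 4 (λ p a b c → p :* a :* b :* c := p :* (a :* b :* c)) refl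
      where open +-*-Solver

  𝔼-cong : ∀ p xs {f g : List A → ℚ} → (∀ S → f S ≡ g S) → 𝔼 p xs f ≡ 𝔼 p xs g
  𝔼-cong p []       f≡g = f≡g []
  𝔼-cong p (x ∷ xs) f≡g = cong₂ (λ a b → (1ℚ - p) * a + p * b) (𝔼-cong p xs f≡g) (𝔼-cong p xs (f≡g ∘ (x ∷_)))

  𝔼-const : ∀ p xs c → 𝔼 p xs (λ _ → c) ≡ c
  𝔼-const p []       c = refl
  𝔼-const p (x ∷ xs) c = trans (cong (λ a → (1ℚ - p) * a + p * a) (𝔼-const p xs c)) (eq p c)
    where
    open +-*-Solver
    eq : ∀ p c → (1ℚ - p) * c + p * c ≡ c
    eq = solve 2 (λ p c → (con 1ℚ :- p) :* c :+ p :* c := c) refl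

  𝔼-+ : ∀ p xs f g → 𝔼 p xs (λ S → f S + g S) ≡ 𝔼 p xs f + 𝔼 p xs g
  𝔼-+ p []       f g = refl
  𝔼-+ p (x ∷ xs) f g = trans (cong₂ (λ a b → (1ℚ - p) * a + p * b) (𝔼-+ p xs f g) (𝔼-+ p xs (f ∘ (x ∷_)) (g ∘ (x ∷_))))
    (eq p (𝔼 p xs f) (𝔼 p xs g) (𝔼 p xs (f ∘ (x ∷_))) (𝔼 p xs (g ∘ (x ∷_))))
    where
    open +-*-Solver
    eq : ∀ p a b c d → (1ℚ - p) * (a + b) + p * (c + d) ≡ ((1ℚ - p) * a + p * c) + ((1ℚ - p) * b + p * d)
    eq = solve 5 (λ p a b c d → (con 1ℚ :- p) :* (a :+ b) :+ p :* (c :+ d) := ((con 1ℚ :- p) :* a :+ p :* c) :+ ((con 1ℚ :- p) :* b :+ p :* d)) refl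

  𝔼-* : ∀ p xs c f → 𝔼 p xs (λ S → c * f S) ≡ c * 𝔼 p xs f
  𝔼-* p []       c f = refl
  𝔼-* p (x ∷ xs) c f = trans (cong₂ (λ a b → (1ℚ - p) * a + p * b) (𝔼-* p xs c f) (𝔼-* p xs c (f ∘ (x ∷_))))
    (eq p c (𝔼 p xs f) (𝔼 p xs (f ∘ (x ∷_))))
    where
    open +-*-Solver
    eq : ∀ p c a b → (1ℚ - p) * (c * a) + p * (c * b) ≡ c * ((1ℚ - p) * a + p * b)
    eq = solve 4 (λ p c a b → (con 1ℚ :- p) :* (c :* a) :+ p :* (c :* b) := c :* ((con 1ℚ :- p) :* a :+ p :* b)) refl

  𝔼-++ : ∀ p xs ys f → 𝔼 p (xs ++ ys) f ≡ 𝔼 p xs (λ S → 𝔼 p ys (λ T → f (S ++ T)))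
  𝔼-++ p []       ys f = refl
  𝔼-++ p (x ∷ xs) ys f = cong₂ (λ a b → (1ℚ - p) * a + p * b) (𝔼-++ p xs ys f) (𝔼-++ p xs ys (f ∘ (x ∷_)))

  𝔼-↭ : ∀ p {xs ys f} → ↭-Invariant f → xs ↭ ys → 𝔼 p xs f ≡ 𝔼 p ys f
  𝔼-↭ p inv refl = refl
  𝔼-↭ p inv (prep x xs↭ys) = cong₂ (λ a b → (1ℚ - p) * a + p * b) (𝔼-↭ p inv xs↭ys) (𝔼-↭ p (inv ∘ prep x) xs↭ys)
  𝔼-↭ p {_ ∷ _ ∷ xs} {_ ∷ _ ∷ ys} {f} inv (swap x y xs↭ys) = begin
    (1ℚ - p) * ((1ℚ - p) * E xs f + p * E xs fy) + p * ((1ℚ - p) * E xs fx + p * E xs fxy)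
      ≡⟨ cong₂ (λ a b → (1ℚ - p) * ((1ℚ - p) * a + p * b) + p * ((1ℚ - p) * E xs fx + p * E xs fxy)) (𝔼-↭ p inv xs↭ys) (𝔼-↭ p (inv ∘ prep y) xs↭ys) ⟩
    (1ℚ - p) * ((1ℚ - p) * E ys f + p * E ys fy) + p * ((1ℚ - p) * E xs fx + p * E xs fxy)
      ≡⟨ cong₂ (λ a b → (1ℚ - p) * ((1ℚ - p) * E ys f + p * E ys fy) + p * ((1ℚ - p) * a + p * b)) (𝔼-↭ p (inv ∘ prep x) xs↭ys)
           (trans (𝔼-↭ p (inv ∘ prep x ∘ prep y) xs↭ys) (𝔼-cong p ys (λ S → inv (swap x y ↭-refl)))) ⟩
    (1ℚ - p) * ((1ℚ - p) * E ys f + p * E ys fy) + p * ((1ℚ - p) * E ys fx + p * E ys fyx)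
      ≡⟨ eq p (E ys f) (E ys fx) (E ys fy) (E ys fyx) ⟩
    (1ℚ - p) * ((1ℚ - p) * E ys f + p * E ys fx) + p * ((1ℚ - p) * E ys fy + p * E ys fyx) ∎
    where
    open ≡-Reasoning
    E = 𝔼 p
    fx fy fxy fyx : List A → ℚ
    fx  S = f (x ∷ S)
    fy  S = f (y ∷ S)
    fxy S = f (x ∷ y ∷ S)
    fyx S = f (y ∷ x ∷ S)
    eq : ∀ p a b c d → (1ℚ - p) * ((1ℚ - p) * a + p * c) + p * ((1ℚ - p) * b + p * d) ≡ (1ℚ - p) * ((1ℚ - p) * a + p * b) + p * ((1ℚ - p) * c + p * d)
    eq = solve 5 (λ p a b c d → (con 1ℚ :- p) :* ((con 1ℚ :- p) :* a :+ p :* c) :+ p :* ((con 1ℚ :- p) :* b :+ p :* d) := (con 1ℚ :- p) :* ((con 1ℚ :- p) :* a :+ p :* b) :+ p :* ((con 1ℚ :- p) :* c :+ p :* d)) refl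
      where open +-*-Solver
  𝔼-↭ p inv (_↭_.trans xs↭ys ys↭zs) = trans (𝔼-↭ p inv xs↭ys) (𝔼-↭ p inv ys↭zs)

  -- The generating function of a binomial variable, evaluated at `r`.
  𝔼-pow-length : ∀ p r xs → 𝔼 p xs (pow r ∘ length) ≡ pow (1ℚ - p + p * r) (length xs)
  𝔼-pow-length p r []       = refl
  𝔼-pow-length p r (x ∷ xs) = begin
    (1ℚ - p) * 𝔼 p xs (pow r ∘ length) + p * 𝔼 p xs (λ S → r * pow r (length S))
      ≡⟨ cong (λ a → (1ℚ - p) * 𝔼 p xs (pow r ∘ length) + p * a) (𝔼-* p xs r (pow r ∘ length)) ⟩
    (1ℚ - p) * 𝔼 p xs (pow r ∘ length) + p * (r * 𝔼 p xs (pow r ∘ length))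
      ≡⟨ cong (λ a → (1ℚ - p) * a + p * (r * a)) (𝔼-pow-length p r xs) ⟩
    (1ℚ - p) * b + p * (r * b)
      ≡⟨ eq p r b ⟩
    (1ℚ - p + p * r) * b ∎
    where
    open ≡-Reasoning
    b = pow (1ℚ - p + p * r) (length xs)
    eq : ∀ p r b → (1ℚ - p) * b + p * (r * b) ≡ (1ℚ - p + p * r) * b
    eq = solve 3 (λ p r b → (con 1ℚ :- p) :* b :+ p :* (r :* b) := (con 1ℚ :- p :+ p :* r) :* b) refl
      where open +-*-Solver

  𝔼-∑-subset : ∀ p xs h → 𝔼 p xs (λ S → ∑ S h) ≡ p * ∑ xs h
  𝔼-∑-subset p []       h = ≡.sym (ℚ.*-zeroʳ p)
  𝔼-∑-subset p (x ∷ xs) h = begin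
    (1ℚ - p) * 𝔼 p xs (λ S → ∑ S h) + p * 𝔼 p xs (λ S → h x + ∑ S h)
      ≡⟨ cong (λ a → (1ℚ - p) * 𝔼 p xs (λ S → ∑ S h) + p * a) (trans (𝔼-+ p xs (λ _ → h x) (λ S → ∑ S h)) (cong (_+ 𝔼 p xs (λ S → ∑ S h)) (𝔼-const p xs (h x)))) ⟩
    (1ℚ - p) * 𝔼 p xs (λ S → ∑ S h) + p * (h x + 𝔼 p xs (λ S → ∑ S h))
      ≡⟨ cong (λ a → (1ℚ - p) * a + p * (h x + a)) (𝔼-∑-subset p xs h) ⟩
    (1ℚ - p) * (p * ∑ xs h) + p * (h x + p * ∑ xs h)
      ≡⟨ eq p (h x) (∑ xs h) ⟩
    p * (h x + ∑ xs h) ∎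
    where
    open ≡-Reasoning
    eq : ∀ p a s → (1ℚ - p) * (p * s) + p * (a + p * s) ≡ p * (a + s)
    eq = solve 3 (λ p a s → (con 1ℚ :- p) :* (p :* s) :+ p :* (a :+ p :* s) := p :* (a :+ s)) refl
      where open +-*-Solver

  𝔼-∑-swap : ∀ p xs ys (h : A → List A → ℚ) → 𝔼 p xs (λ S → ∑ ys (λ y → h y S)) ≡ ∑ ys (λ y → 𝔼 p xs (h y))
  𝔼-∑-swap p xs []       h = 𝔼-const p xs 0ℚ
  𝔼-∑-swap p xs (y ∷ ys) h = trans (𝔼-+ p xs (h y) (λ S → ∑ ys (λ y → h y S))) (cong (𝔼 p xs (h y) +_) (𝔼-∑-swap p xs ys h))

  𝔼₂-forget : ∀ p xs f → 𝔼₂ p xs (λ S _ → f S) ≡ 𝔼 p xs f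
  𝔼₂-forget p []       f = refl
  𝔼₂-forget p (x ∷ xs) f = cong₂ (λ a b → (1ℚ - p) * a + p * b) (𝔼₂-forget p xs f) (𝔼₂-forget p xs (f ∘ (x ∷_)))

  𝔼₂-cong : ∀ p xs {f g : List A → List A → ℚ} → (∀ S U → f S U ≡ g S U) → 𝔼₂ p xs f ≡ 𝔼₂ p xs g
  𝔼₂-cong p []       f≡g = f≡g [] []
  𝔼₂-cong p (x ∷ xs) f≡g = cong₂ (λ a b → (1ℚ - p) * a + p * b) (𝔼₂-cong p xs (λ S U → f≡g S (x ∷ U))) (𝔼₂-cong p xs (λ S U → f≡g (x ∷ S) U))

  𝔼₂-+ : ∀ p xs f g → 𝔼₂ p xs (λ S U → f S U + g S U) ≡ 𝔼₂ p xs f + 𝔼₂ p xs g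
  𝔼₂-+ p []       f g = refl
  𝔼₂-+ p (x ∷ xs) f g = trans
    (cong₂ (λ a b → (1ℚ - p) * a + p * b) (𝔼₂-+ p xs (λ S U → f S (x ∷ U)) (λ S U → g S (x ∷ U))) (𝔼₂-+ p xs (f ∘ (x ∷_)) (g ∘ (x ∷_))))
    (eq p (𝔼₂ p xs (λ S U → f S (x ∷ U))) (𝔼₂ p xs (λ S U → g S (x ∷ U))) (𝔼₂ p xs (f ∘ (x ∷_))) (𝔼₂ p xs (g ∘ (x ∷_))))
    where
    open +-*-Solver
    eq : ∀ p a b c d → (1ℚ - p) * (a + b) + p * (c + d) ≡ ((1ℚ - p) * a + p * c) + ((1ℚ - p) * b + p * d)
    eq = solve 5 (λ p a b c d → (con 1ℚ :- p) :* (a :+ b) :+ p :* (c :+ d) := ((con 1ℚ :- p) :* a :+ p :* c) :+ ((con 1ℚ :- p) :* b :+ p :* d)) refl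

  𝔼₂-* : ∀ p xs c f → 𝔼₂ p xs (λ S U → c * f S U) ≡ c * 𝔼₂ p xs f
  𝔼₂-* p []       c f = refl
  𝔼₂-* p (x ∷ xs) c f = trans (cong₂ (λ a b → (1ℚ - p) * a + p * b) (𝔼₂-* p xs c (λ S U → f S (x ∷ U))) (𝔼₂-* p xs c (f ∘ (x ∷_))))
    (eq p c (𝔼₂ p xs (λ S U → f S (x ∷ U))) (𝔼₂ p xs (f ∘ (x ∷_))))
    where
    open +-*-Solver
    eq : ∀ p c a b → (1ℚ - p) * (c * a) + p * (c * b) ≡ c * ((1ℚ - p) * a + p * b)
    eq = solve 4 (λ p c a b → (con 1ℚ :- p) :* (c :* a) :+ p :* (c :* b) := c :* ((con 1ℚ :- p) :* a :+ p :* b)) refl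

  -- An element survives if the first round keeps it, or misses it and the second keeps it, which
  -- has probability `p + (1 - p) q`. Invariance of `f` is what brings an element kept in the first
  -- round from the middle of `T ++ x ∷ S` to the front.
  𝔼-sprinkle : ∀ p q xs {f} → ↭-Invariant f →
    𝔼 (p + (1ℚ - p) * q) xs f ≡ 𝔼₂ p xs (λ S U → 𝔼 q U (λ T → f (T ++ S)))
  𝔼-sprinkle p q []       inv = refl
  𝔼-sprinkle p q (x ∷ xs) {f} inv = begin
    (1ℚ - s) * 𝔼 s xs f + s * 𝔼 s xs (f ∘ (x ∷_))
      ≡⟨ cong₂ (λ a b → (1ℚ - s) * a + s * b) (𝔼-sprinkle p q xs inv) (𝔼-sprinkle p q xs (inv ∘ prep x)) ⟩
    (1ℚ - s) * a + s * b
      ≡⟨ eq p q a b ⟩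
    (1ℚ - p) * ((1ℚ - q) * a + q * b) + p * b
      ≡⟨ cong₂ (λ u v → (1ℚ - p) * u + p * v)
           (≡.sym (trans (𝔼₂-+ p xs (λ S U → (1ℚ - q) * 𝔼 q U (λ T → f (T ++ S))) (λ S U → q * 𝔼 q U (λ T → f (x ∷ T ++ S))))
                         (cong₂ _+_ (𝔼₂-* p xs (1ℚ - q) (λ S U → 𝔼 q U (λ T → f (T ++ S)))) (𝔼₂-* p xs q (λ S U → 𝔼 q U (λ T → f (x ∷ T ++ S)))))))
           (𝔼₂-cong p xs (λ S U → 𝔼-cong q U (λ T → inv (↭-sym (shift x T S))))) ⟩
    (1ℚ - p) * 𝔼₂ p xs (λ S U → (1ℚ - q) * 𝔼 q U (λ T → f (T ++ S)) + q * 𝔼 q U (λ T → f (x ∷ T ++ S)))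
      + p * 𝔼₂ p xs (λ S U → 𝔼 q U (λ T → f (T ++ x ∷ S))) ∎
    where
    open ≡-Reasoning
    s = p + (1ℚ - p) * q
    a = 𝔼₂ p xs (λ S U → 𝔼 q U (λ T → f (T ++ S)))
    b = 𝔼₂ p xs (λ S U → 𝔼 q U (λ T → f (x ∷ T ++ S)))
    eq : ∀ p q a b → (1ℚ - (p + (1ℚ - p) * q)) * a + (p + (1ℚ - p) * q) * b ≡ (1ℚ - p) * ((1ℚ - q) * a + q * b) + p * b
    eq = solve 4 (λ p q a b → (con 1ℚ :- (p :+ (con 1ℚ :- p) :* q)) :* a :+ (p :+ (con 1ℚ :- p) :* q) :* b
                   := (con 1ℚ :- p) :* ((con 1ℚ :- q) :* a :+ q :* b) :+ p :* b) refl
      where open +-*-Solver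

  -- Inequalities between expectations.

  module _ {p} (0≤p : 0ℚ ≤ p) (p≤1 : p ≤ 1ℚ) where

    mix-mono : ∀ {a b c d} → a ≤ c → b ≤ d → (1ℚ - p) * a + p * b ≤ (1ℚ - p) * c + p * d
    mix-mono a≤c b≤d = ℚ.+-mono-≤ (*-monoˡ (≤⇒0≤- p≤1) a≤c) (*-monoˡ 0≤p b≤d)

    𝔼-mono-Sublist : ∀ xs {f g : List A → ℚ} → (∀ {S} → Sublist S xs → f S ≤ g S) → 𝔼 p xs f ≤ 𝔼 p xs g
    𝔼-mono-Sublist []       f≤g = f≤g []
    𝔼-mono-Sublist (x ∷ xs) f≤g = mix-mono (𝔼-mono-Sublist xs (f≤g ∘ (x ∷ʳ_))) (𝔼-mono-Sublist xs (λ S≤ → f≤g (refl ∷ S≤)))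

    𝔼-mono : ∀ xs {f g : List A → ℚ} → (∀ S → f S ≤ g S) → 𝔼 p xs f ≤ 𝔼 p xs g
    𝔼-mono xs f≤g = 𝔼-mono-Sublist xs (λ {S} _ → f≤g S)

    𝔼₂-mono : ∀ xs {f g : List A → List A → ℚ} → (∀ S U → S ++ U ↭ xs → f S U ≤ g S U) → 𝔼₂ p xs f ≤ 𝔼₂ p xs g
    𝔼₂-mono []       f≤g = f≤g [] [] refl
    𝔼₂-mono (x ∷ xs) f≤g = mix-mono
      (𝔼₂-mono xs (λ S U SU↭ → f≤g S (x ∷ U) (↭-trans (shift x S U) (prep x SU↭))))
      (𝔼₂-mono xs (λ S U SU↭ → f≤g (x ∷ S) U (prep x SU↭)))

    -- For each outcome on `ys`, whatever is kept from `zs` can only lower `f`. This lets the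
    -- exploration discard edges that it cannot use.
    𝔼-antitone-drop : ∀ {xs ys zs f} → Antitone f → xs ↭ ys ++ zs → 𝔼 p xs f ≤ 𝔼 p ys f
    𝔼-antitone-drop {xs} {ys} {zs} {f} anti xs↭ = begin
      𝔼 p xs f                                  ≡⟨ 𝔼-↭ p (antitone⇒invariant anti) xs↭ ⟩
      𝔼 p (ys ++ zs) f                          ≡⟨ 𝔼-++ p ys zs f ⟩
      𝔼 p ys (λ S → 𝔼 p zs (λ T → f (S ++ T)))  ≤⟨ 𝔼-mono ys (λ S → 𝔼-mono zs (λ T → anti (⊆.xs⊆xs++ys S T))) ⟩
      𝔼 p ys (λ S → 𝔼 p zs (λ T → f S))         ≡⟨ 𝔼-cong p ys (λ S → 𝔼-const p zs (f S)) ⟩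
      𝔼 p ys f                                  ∎
      where open ≤-Reasoning

    -- Harris' inequality by conditioning on the head. The mixture of the products exceeds the
    -- product of the mixtures by `p (1 - p) (f₁ - f₀) (g₁ - g₀)`, and both differences are
    -- nonnegative for isotone functions.
    harris : ∀ xs {f g : List A → ℚ} → Isotone f → Isotone g → 𝔼 p xs f * 𝔼 p xs g ≤ 𝔼 p xs (λ S → f S * g S)
    harris []       f↑ g↑ = ≤-refl
    harris (x ∷ xs) {f} {g} f↑ g↑ = ≤-trans
      (≤-by-gap (p * (1ℚ - p) * ((f₁ - f₀) * (g₁ - g₀)))
         (0≤* (0≤* 0≤p (≤⇒0≤- p≤1)) (0≤* (≤⇒0≤- (𝔼-mono xs (λ S → f↑ there))) (≤⇒0≤- (𝔼-mono xs (λ S → g↑ there)))))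
         (eq p f₀ f₁ g₀ g₁))
      (mix-mono (harris xs f↑ g↑) (harris xs (f↑ ∘ ⊆.∷⁺ʳ x) (g↑ ∘ ⊆.∷⁺ʳ x)))
      where
      f₀ = 𝔼 p xs f
      f₁ = 𝔼 p xs (f ∘ (x ∷_))
      g₀ = 𝔼 p xs g
      g₁ = 𝔼 p xs (g ∘ (x ∷_))
      eq : ∀ p a b c d → (1ℚ - p) * (a * c) + p * (b * d) ≡ ((1ℚ - p) * a + p * b) * ((1ℚ - p) * c + p * d) + p * (1ℚ - p) * ((b - a) * (d - c))
      eq = solve 5 (λ p a b c d → (con 1ℚ :- p) :* (a :* c) :+ p :* (b :* d) := ((con 1ℚ :- p) :* a :+ p :* b) :* ((con 1ℚ :- p) :* c :+ p :* d) :+ p :* (con 1ℚ :- p) :* ((b :- a) :* (d :- c))) refl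
        where open +-*-Solver

𝔼-map : ∀ {A B : Set} p (h : A → B) xs f → 𝔼 p (map h xs) f ≡ 𝔼 p xs (f ∘ map h)
𝔼-map p h []       f = refl
𝔼-map p h (x ∷ xs) f = cong₂ (λ a b → (1ℚ - p) * a + p * b) (𝔼-map p h xs f) (𝔼-map p h xs (f ∘ (h x ∷_)))

-- Connectivity and components

module _ {A : Set} where

  cnt : {P : A → Set} → Decidable P → List A → ℕ
  cnt P? xs = length (filter P? xs)

  cnt-⊎ : ∀ {P Q R : A → Set} (P? : Decidable P) (Q? : Decidable Q) (R? : Decidable R) →
    (∀ x → P x → Q x ⊎ R x) → ∀ xs → cnt P? xs ℕ.≤ cnt Q? xs ℕ.+ cnt R? xs
  cnt-⊎ P? Q? R? P⇒ []       = ℕ.z≤n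
  cnt-⊎ P? Q? R? P⇒ (x ∷ xs) with ih ← cnt-⊎ P? Q? R? P⇒ xs | P? x | Q? x | R? x
  ... | yes _  | yes _  | yes _  = ℕ.s≤s (ℕ.≤-trans ih (ℕ.+-monoʳ-≤ (cnt Q? xs) (ℕ.n≤1+n (cnt R? xs))))
  ... | yes _  | yes _  | no _   = ℕ.s≤s ih
  ... | yes _  | no _   | yes _  = ℕ.≤-trans (ℕ.s≤s ih) (ℕ.≤-reflexive (≡.sym (ℕ.+-suc (cnt Q? xs) (cnt R? xs))))
  ... | yes p  | no ¬q  | no ¬r  = contradiction (P⇒ x p) [ ¬q , ¬r ]′
  ... | no _   | yes _  | yes _  = ℕ.m≤n⇒m≤1+n (ℕ.≤-trans ih (ℕ.+-monoʳ-≤ (cnt Q? xs) (ℕ.n≤1+n (cnt R? xs))))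
  ... | no _   | yes _  | no _   = ℕ.m≤n⇒m≤1+n ih
  ... | no _   | no _   | yes _  = ℕ.≤-trans ih (ℕ.+-monoʳ-≤ (cnt Q? xs) (ℕ.n≤1+n (cnt R? xs)))
  ... | no _   | no _   | no _   = ih

  cnt-mono : ∀ {P Q : A → Set} (P? : Decidable P) (Q? : Decidable Q) →
    (∀ x → P x → Q x) → ∀ xs → cnt P? xs ℕ.≤ cnt Q? xs
  cnt-mono P? Q? P⇒Q []       = ℕ.z≤n
  cnt-mono P? Q? P⇒Q (x ∷ xs) with ih ← cnt-mono P? Q? P⇒Q xs | P? x | Q? x
  ... | yes _ | yes _ = ℕ.s≤s ih
  ... | yes p | no ¬q = contradiction (P⇒Q x p) ¬q
  ... | no _  | yes _ = ℕ.m≤n⇒m≤1+n ih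
  ... | no _  | no _  = ih

  -- The members of `ys` are pulled out of `xs` one by one. As they are distinct, removing one
  -- occurrence of `y` never takes away a member still to come. The leftover `zs` is what
  -- `𝔼-antitone-drop` discards.
  Unique-⊆⇒↭ : ∀ {xs ys : List A} → Unique ys → ys ⊆ xs → ∃[ zs ] xs ↭ ys ++ zs
  Unique-⊆⇒↭ {xs} {[]}     _          _     = xs , ↭-refl
  Unique-⊆⇒↭ {xs} {y ∷ ys} (y≢ ∷ uys) ys⊆xs with ∈-∃++ (ys⊆xs (here refl))
  ... | as , bs , refl with Unique-⊆⇒↭ {as ++ bs} uys ys⊆
    where
    ys⊆ : ys ⊆ as ++ bs
    ys⊆ {z} z∈ys with ∈-resp-↭ (shift y as bs) (ys⊆xs (there z∈ys))
    ... | here z≡y  = contradiction (≡.sym z≡y) (All.lookup y≢ z∈ys)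
    ... | there z∈  = z∈
  ... | zs , p = zs , ↭-trans (shift y as bs) (prep y p)

  Unique-⊆⇒length≤ : ∀ {xs ys : List A} → Unique ys → ys ⊆ xs → length ys ℕ.≤ length xs
  Unique-⊆⇒length≤ {xs} {ys} uys ys⊆xs with Unique-⊆⇒↭ uys ys⊆xs
  ... | zs , p = ℕ.≤-trans (ℕ.m≤m+n (length ys) (length zs))
    (ℕ.≤-reflexive (≡.sym (trans (↭-length p) (List.length-++ ys))))

  filter-complement-↭ : ∀ {P : A → Set} (P? : Decidable P) xs → xs ↭ filter P? xs ++ filter (¬? ∘ P?) xs
  filter-complement-↭ P? []       = ↭-refl
  filter-complement-↭ P? (x ∷ xs) with ih ← filter-complement-↭ P? xs | P? x
  ... | yes _ = prep x ih
  ... | no  _ = ↭-trans (prep x ih) (↭-sym (shift x (filter P? xs) (filter (¬? ∘ P?) xs)))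

  cnt≤1 : ∀ {P : A → Set} (P? : Decidable P) {xs} → Unique xs → (∀ x y → P x → P y → x ≡ y) → cnt P? xs ℕ.≤ 1
  cnt≤1 P? {xs} uxs same with filter P? xs | Unique.filter⁺ P? uxs | (λ {x} → ∈-filter⁻ P? {v = x} {xs = xs})
  ... | []        | _              | _  = ℕ.z≤n
  ... | _ ∷ []    | _              | _  = ℕ.≤-refl
  ... | x ∷ y ∷ _ | (x≢y ∷ _) ∷ _  | P∈ = contradiction (same x y (proj₂ (P∈ (here refl))) (proj₂ (P∈ (there (here refl))))) x≢y

module _ {A B : Set} (g : A → List B) where

  Unique-concatMap : ∀ {xs} → Unique xs → (∀ x → Unique (g x)) →
    (∀ {x y z} → x ∈ xs → y ∈ xs → z ∈ g x → z ∈ g y → x ≡ y) → Unique (concatMap g xs)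
  Unique-concatMap []                  ug dis = []
  Unique-concatMap {x ∷ xs} (x≢ ∷ uxs) ug dis =
    Unique.++⁺ (ug x) (Unique-concatMap uxs ug (λ x∈ y∈ → dis (there x∈) (there y∈)))
      λ { (z∈gx , z∈) → apart z∈gx (Any.map id (∈-concatMap⁻ g {xs} z∈)) }
    where
    apart : ∀ {z} → z ∈ g x → Any (λ y → z ∈ g y) xs → ⊥
    apart z∈gx any with find any
    ... | y , y∈ , z∈gy = All.lookup x≢ y∈ (dis (here refl) (there y∈) z∈gx z∈gy)

  length-concatMap≥ : ∀ {m xs} → (∀ {x} → x ∈ xs → m ℕ.≤ length (g x)) → length xs ℕ.* m ℕ.≤ length (concatMap g xs)
  length-concatMap≥ {xs = []}     m≤ = ℕ.z≤n
  length-concatMap≥ {xs = x ∷ xs} m≤ = ℕ.≤-trans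
    (ℕ.+-mono-≤ (m≤ (here refl)) (length-concatMap≥ (m≤ ∘ there)))
    (ℕ.≤-reflexive (≡.sym (List.length-++ (g x))))

length-allFin : ∀ n → length (allFin n) ≡ n
length-allFin n = List.length-tabulate id

module _ {n : ℕ} where

  -- Connectivity, maintained as in a union-find structure: adding an edge merges two classes.
  Conn : List (Edge n) → Fin n → Fin n → Set
  Conn []            u v = u ≡ v
  Conn ((a , b) ∷ S) u v = Conn S u v ⊎ (Conn S u a × Conn S b v) ⊎ (Conn S u b × Conn S a v)

  Conn? : ∀ S u v → Dec (Conn S u v)
  Conn? []            u v = u Fin.≟ v
  Conn? ((a , b) ∷ S) u v = Conn? S u v ⊎-dec (Conn? S u a ×-dec Conn? S b v) ⊎-dec (Conn? S u b ×-dec Conn? S a v)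

  Conn-refl : ∀ S {u} → Conn S u u
  Conn-refl []      = refl
  Conn-refl (_ ∷ S) = inj₁ (Conn-refl S)

  Conn-sym : ∀ S {u v} → Conn S u v → Conn S v u
  Conn-sym []      refl                    = refl
  Conn-sym (_ ∷ S) (inj₁ p)                = inj₁ (Conn-sym S p)
  Conn-sym (_ ∷ S) (inj₂ (inj₁ (p , q)))   = inj₂ (inj₂ (Conn-sym S q , Conn-sym S p))
  Conn-sym (_ ∷ S) (inj₂ (inj₂ (p , q)))   = inj₂ (inj₁ (Conn-sym S q , Conn-sym S p))

  Conn-trans : ∀ S {u v w} → Conn S u v → Conn S v w → Conn S u w
  Conn-trans []      refl q = q
  Conn-trans (_ ∷ S) (inj₁ p)              (inj₁ q)              = inj₁ (Conn-trans S p q)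
  Conn-trans (_ ∷ S) (inj₁ p)              (inj₂ (inj₁ (q , r))) = inj₂ (inj₁ (Conn-trans S p q , r))
  Conn-trans (_ ∷ S) (inj₁ p)              (inj₂ (inj₂ (q , r))) = inj₂ (inj₂ (Conn-trans S p q , r))
  Conn-trans (_ ∷ S) (inj₂ (inj₁ (p , q))) (inj₁ r)              = inj₂ (inj₁ (p , Conn-trans S q r))
  Conn-trans (_ ∷ S) (inj₂ (inj₂ (p , q))) (inj₁ r)              = inj₂ (inj₂ (p , Conn-trans S q r))
  Conn-trans (_ ∷ S) (inj₂ (inj₁ (p , q))) (inj₂ (inj₁ (r , s))) = inj₂ (inj₁ (p , s))
  Conn-trans (_ ∷ S) (inj₂ (inj₁ (p , q))) (inj₂ (inj₂ (r , s))) = inj₁ (Conn-trans S p s)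
  Conn-trans (_ ∷ S) (inj₂ (inj₂ (p , q))) (inj₂ (inj₁ (r , s))) = inj₁ (Conn-trans S p s)
  Conn-trans (_ ∷ S) (inj₂ (inj₂ (p , q))) (inj₂ (inj₂ (r , s))) = inj₂ (inj₂ (p , s))

  Conn-edge : ∀ {S a b} → (a , b) ∈ S → Conn S a b
  Conn-edge {_ ∷ S} (here refl) = inj₂ (inj₁ (Conn-refl S , Conn-refl S))
  Conn-edge {_ ∷ S} (there e∈)  = inj₁ (Conn-edge e∈)

  -- The universal property of `Conn S`, the least equivalence containing the edges. Monotonicity
  -- and the isolation of untouched vertices come from suitable choices of `R`.
  Conn-minimal : ∀ S {R : Fin n → Fin n → Set} → (∀ {u} → R u u) → (∀ {u v} → R u v → R v u) →
    (∀ {u v w} → R u v → R v w → R u w) → (∀ {a b} → (a , b) ∈ S → R a b) → ∀ {u v} → Conn S u v → R u v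
  Conn-minimal []      r s t e refl                  = r
  Conn-minimal (_ ∷ S) r s t e (inj₁ p)              = Conn-minimal S r s t (e ∘ there) p
  Conn-minimal (_ ∷ S) r s t e (inj₂ (inj₁ (p , q))) =
    t (Conn-minimal S r s t (e ∘ there) p) (t (e (here refl)) (Conn-minimal S r s t (e ∘ there) q))
  Conn-minimal (_ ∷ S) r s t e (inj₂ (inj₂ (p , q))) =
    t (Conn-minimal S r s t (e ∘ there) p) (t (s (e (here refl))) (Conn-minimal S r s t (e ∘ there) q))

  Conn-mono : ∀ {S T} → S ⊆ T → ∀ {u v} → Conn S u v → Conn T u v
  Conn-mono {S} {T} S⊆T = Conn-minimal S (Conn-refl T) (Conn-sym T) (Conn-trans T) (Conn-edge ∘ S⊆T)

  adjacentIn⇒Conn : ∀ S {u v} → T (adjacentIn S u v) → Conn S u v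
  adjacentIn⇒Conn S {u} {v} adj = go id (Any.any⁻ _ S adj)
    where
    go : ∀ {S′} → S′ ⊆ S → Any (λ e → T ((⌊ proj₁ e Fin.≟ u ⌋ ∧ ⌊ proj₂ e Fin.≟ v ⌋)
      ∨ (⌊ proj₁ e Fin.≟ v ⌋ ∧ ⌊ proj₂ e Fin.≟ u ⌋))) S′ → Conn S u v
    go S′⊆S (there any) = go (S′⊆S ∘ there) any
    go S′⊆S (here {a , b} t) with Equivalence.to (Bool.T-∨ {⌊ a Fin.≟ u ⌋ ∧ ⌊ b Fin.≟ v ⌋}) t
    ... | inj₁ t₁ with a≡u , b≡v ← Equivalence.to (Bool.T-∧ {⌊ a Fin.≟ u ⌋}) t₁
        with refl ← toWitness {a? = a Fin.≟ u} a≡u | refl ← toWitness {a? = b Fin.≟ v} b≡v = Conn-edge (S′⊆S (here refl))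
    ... | inj₂ t₂ with a≡v , b≡u ← Equivalence.to (Bool.T-∧ {⌊ a Fin.≟ v ⌋}) t₂
        with refl ← toWitness {a? = a Fin.≟ v} a≡v | refl ← toWitness {a? = b Fin.≟ u} b≡u = Conn-sym S (Conn-edge (S′⊆S (here refl)))

  iter-step⇒Conn : ∀ S t v u → T (iter t (step S) (λ w → ⌊ w Fin.≟ v ⌋) u) → Conn S v u
  iter-step⇒Conn S zero    v u t with refl ← toWitness {a? = u Fin.≟ v} t = Conn-refl S
  iter-step⇒Conn S (suc m) v u t with Equivalence.to (Bool.T-∨ {iter m (step S) (λ w → ⌊ w Fin.≟ v ⌋) u}) t
  ... | inj₁ t₁ = iter-step⇒Conn S m v u t₁
  ... | inj₂ t₂ with w , t₃ ← Any.satisfied (Any.any⁻ _ (allFin n) t₂)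
      with r , a ← Equivalence.to (Bool.T-∧ {iter m (step S) (λ w → ⌊ w Fin.≟ v ⌋) w}) t₃ =
    Conn-trans S (iter-step⇒Conn S m v w r) (adjacentIn⇒Conn S a)

  Least : List (Edge n) → Fin n → Set
  Least S v = ¬ ∃ λ u → u <ᶠ v × Conn S v u

  Least? : ∀ S v → Dec (Least S v)
  Least? S v = ¬? (Fin.any? (λ u → u <? v ×-dec Conn? S v u))

  comp : List (Edge n) → ℕ
  comp S = cnt (Least? S) (allFin n)

  -- A lower bound on the excess asks for a lower bound on `components`, and soundness of
  -- `reachable` provides it: whatever the Boolean closure reaches is connected, so a vertex least
  -- in its `Conn` class passes the Boolean test.
  comp≤components : ∀ S → comp S ℕ.≤ components S
  comp≤components S = cnt-mono (Least? S) (λ v → _ Bool.≟ true)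
    (λ v least → Equivalence.to Bool.T-≡ (All.all⁻ _ (All.universal (λ u → earlier v u least) (allFin n)))) (allFin n)
    where
    earlier : ∀ v u → Least S v → T (not (⌊ u <? v ⌋ ∧ reachable S v u))
    earlier v u least with u <? v | reachable S v u in eq
    ... | no _    | _           = _
    ... | yes _   | false = _
    ... | yes u<v | true        = least (u , u<v , iter-step⇒Conn S n v u (Equivalence.from Bool.T-≡ eq))

  comp-antitone : ∀ {S T} → (∀ {u v} → Conn S u v → Conn T u v) → comp T ℕ.≤ comp S
  comp-antitone {S} {T} S⇒T = cnt-mono (Least? T) (Least? S) (λ v least (u , u<v , c) → least (u , u<v , S⇒T c)) (allFin n)

  comp-[] : comp [] ≡ n
  comp-[] = trans (cong length (List.filter-all (Least? []) (All.universal least (allFin n)))) (length-allFin n)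
    where
    least : ∀ v → Least [] v
    least v (u , u<v , refl) = Fin.<-irrefl refl u<v

  least-unique : ∀ S {u v} → Least S u → Least S v → Conn S u v → u ≡ v
  least-unique S {u} {v} lu lv c with Fin.<-cmp u v
  ... | tri< u<v _ _ = contradiction (u , u<v , Conn-sym S c) lv
  ... | tri≈ _ u≡v _ = u≡v
  ... | tri> _ _ v<u = contradiction (v , v<u , c) lu

  least-of : ∀ S v → ∃ λ u → Least S u × Conn S v u
  least-of S v = go v (Fin.<-wellFounded v)
    where
    go : ∀ v → Acc _<ᶠ_ v → ∃ λ u → Least S u × Conn S v u
    go v (acc rs) with Fin.any? (λ u → u <? v ×-dec Conn? S v u)
    ... | no least          = v , least , Conn-refl S
    ... | yes (u , u<v , c) with w , least , c′ ← go u (rs u<v) = w , least , Conn-trans S c c′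

  -- An edge merges at most two classes, and only the larger of their two least vertices stops being
  -- least.
  comp-∷ : ∀ e S → comp S ℕ.≤ suc (comp (e ∷ S))
  comp-∷ e@(a , b) S = ℕ.≤-trans
    (cnt-⊎ (Least? S) (Least? (e ∷ S)) Dropped? split (allFin n))
    (ℕ.≤-trans (ℕ.+-monoʳ-≤ (comp (e ∷ S)) (cnt≤1 Dropped? (Unique.allFin⁺ n) dropped-unique))
               (ℕ.≤-reflexive (ℕ.+-comm (comp (e ∷ S)) 1)))
    where
    Dropped : Fin n → Set
    Dropped v = Least S v × ¬ Least (e ∷ S) v
    Dropped? : ∀ v → Dec (Dropped v)
    Dropped? v = Least? S v ×-dec ¬? (Least? (e ∷ S) v)
    split : ∀ v → Least S v → Least (e ∷ S) v ⊎ Dropped v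
    split v least with Least? (e ∷ S) v
    ... | yes l = inj₁ l
    ... | no ¬l = inj₂ (least , ¬l)
    crossing : ∀ {v} → Dropped v → ∃ λ u → u <ᶠ v × (Conn S v a × Conn S b u ⊎ Conn S v b × Conn S a u)
    crossing {v} (least , ¬least) with decidable-stable (Fin.any? (λ u → u <? v ×-dec Conn? (e ∷ S) v u)) ¬least
    ... | u , u<v , inj₁ c = contradiction (u , u<v , c) least
    ... | u , u<v , inj₂ c = u , u<v , c
    below : ∀ {u v} → Least S v → Conn S v u → ¬ u <ᶠ v
    below lv c u<v = lv (_ , u<v , c)
    dropped-unique : ∀ v w → Dropped v → Dropped w → v ≡ w
    dropped-unique v w dv dw with crossing dv | crossing dw
    ... | _ , _ , inj₁ (va , _) | _ , _ , inj₁ (wa , _) = least-unique S (proj₁ dv) (proj₁ dw) (Conn-trans S va (Conn-sym S wa))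
    ... | _ , _ , inj₂ (vb , _) | _ , _ , inj₂ (wb , _) = least-unique S (proj₁ dv) (proj₁ dw) (Conn-trans S vb (Conn-sym S wb))
    -- Here `v` is least in the class of `a` and `w` in that of `b`, while `x` lies with `b` and `y`
    -- with `a`. This would give `w ≤ x < v ≤ y < w`.
    ... | x , x<v , inj₁ (va , bx) | y , y<w , inj₂ (wb , ay) = contradiction
          (ℕ.<-≤-trans y<w (ℕ.≤-trans (ℕ.≮⇒≥ (below (proj₁ dw) (Conn-trans S wb bx))) (ℕ.<⇒≤ x<v)))
          (below (proj₁ dv) (Conn-trans S va ay))
    ... | x , x<v , inj₂ (vb , ax) | y , y<w , inj₁ (wa , by) = contradiction
          (ℕ.<-≤-trans y<w (ℕ.≤-trans (ℕ.≮⇒≥ (below (proj₁ dw) (Conn-trans S wa ax))) (ℕ.<⇒≤ x<v)))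
          (below (proj₁ dv) (Conn-trans S vb by))

  -- The excess is never negative: from `n` singletons, each edge removes at most one class.
  n≤length+comp : ∀ S → n ℕ.≤ length S ℕ.+ comp S
  n≤length+comp []      = ℕ.≤-reflexive (≡.sym comp-[])
  n≤length+comp (e ∷ S) = ℕ.≤-trans (n≤length+comp S)
    (ℕ.≤-trans (ℕ.+-monoʳ-≤ (length S) (comp-∷ e S)) (ℕ.≤-reflexive (ℕ.+-suc (length S) (comp (e ∷ S)))))

  Linked : List (Edge n) → Edge n → Set
  Linked S (a , b) = Conn S a b

  Linked? : ∀ S e → Dec (Linked S e)
  Linked? S (a , b) = Conn? S a b

  Conn-linked : ∀ {S a b} → Conn S a b → ∀ {u v} → Conn ((a , b) ∷ S) u v → Conn S u v
  Conn-linked {S} ab (inj₁ p)              = p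
  Conn-linked {S} ab (inj₂ (inj₁ (p , q))) = Conn-trans S p (Conn-trans S ab q)
  Conn-linked {S} ab (inj₂ (inj₂ (p , q))) = Conn-trans S p (Conn-trans S (Conn-sym S ab) q)

  -- Add the edges of `T` to `X` one by one. An edge whose ends `X` already joins closes a cycle and
  -- leaves `comp` unchanged; any other lowers it by at most one.
  linked+comp : ∀ X T → cnt (Linked? X) T ℕ.+ comp X ℕ.≤ length T ℕ.+ comp (T ++ X)
  linked+comp X []      = ℕ.≤-refl
  linked+comp X (e@(a , b) ∷ T) with ih ← linked+comp X T | Linked? X e
  ... | yes ab = ℕ.s≤s (ℕ.≤-trans ih (ℕ.+-monoʳ-≤ (length T)
          (comp-antitone {e ∷ T ++ X} {T ++ X} (Conn-linked {T ++ X} (Conn-mono (⊆.xs⊆ys++xs X T) ab)))))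
  ... | no  _  = ℕ.≤-trans ih (ℕ.≤-trans (ℕ.+-monoʳ-≤ (length T) (comp-∷ e (T ++ X))) (ℕ.≤-reflexive (ℕ.+-suc (length T) (comp (e ∷ T ++ X)))))

  -- Big components and the excess that they force.

  Big : ℕ → List (Edge n) → Fin n → Set
  Big M S v = M ℕ.≤ cnt (Conn? S v) (allFin n)

  Big? : ∀ M S v → Dec (Big M S v)
  Big? M S v = M ℕ.≤? cnt (Conn? S v) (allFin n)

  Big-mono : ∀ {M S T v} → S ⊆ T → Big M S v → Big M T v
  Big-mono {M} {S} {T} {v} S⊆T big = ℕ.≤-trans big (cnt-mono (Conn? S v) (Conn? T v) (λ _ → Conn-mono S⊆T) (allFin n))

  BigEnds : ℕ → List (Edge n) → Edge n → Set
  BigEnds M S (a , b) = Big M S a × Big M S b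

  BigEnds? : ∀ M S e → Dec (BigEnds M S e)
  BigEnds? M S (a , b) = Big? M S a ×-dec Big? M S b

  bigRoots : ℕ → List (Edge n) → List (Fin n)
  bigRoots M S = filter (λ v → Least? S v ×-dec Big? M S v) (allFin n)

  -- The classes of distinct roots are disjoint and have at least `M` members each, so their
  -- concatenation is a list of distinct vertices.
  bigRoots-few : ∀ M S → length (bigRoots M S) ℕ.* M ℕ.≤ n
  bigRoots-few M S = ℕ.≤-trans
    (length-concatMap≥ cls (λ r∈ → proj₂ (proj₂ (root⁻ r∈))))
    (ℕ.≤-trans
      (Unique-⊆⇒length≤ {xs = allFin n}
        (Unique-concatMap cls (Unique.filter⁺ root? (Unique.allFin⁺ n)) (λ r → Unique.filter⁺ (Conn? S r) (Unique.allFin⁺ n))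
          (λ r∈ s∈ z∈r z∈s → least-unique S (proj₁ (proj₂ (root⁻ r∈))) (proj₁ (proj₂ (root⁻ s∈)))
             (Conn-trans S (proj₂ (∈-filter⁻ (Conn? S _) {xs = allFin n} z∈r)) (Conn-sym S (proj₂ (∈-filter⁻ (Conn? S _) {xs = allFin n} z∈s))))))
        (λ {x} _ → ∈-allFin x))
      (ℕ.≤-reflexive (length-allFin n)))
    where
    root? : ∀ v → Dec (Least S v × Big M S v)
    root? v = Least? S v ×-dec Big? M S v
    cls : Fin n → List (Fin n)
    cls r = filter (Conn? S r) (allFin n)
    root⁻ : ∀ {v} → v ∈ bigRoots M S → v ∈ allFin n × Least S v × Big M S v
    root⁻ = ∈-filter⁻ root? {xs = allFin n}

  -- Joining all big components to the vertex z costs few edges,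
  -- and afterwards every edge between big components closes a cycle.
  excess-bound : Fin n → ∀ M S T →
    n ℕ.+ cnt (BigEnds? M S) T ℕ.≤ length (T ++ S) ℕ.+ comp (T ++ S) ℕ.+ length (bigRoots M S)
  excess-bound z M S T = begin
    n ℕ.+ b                                 ≤⟨ ℕ.+-mono-≤ (n≤length+comp X) (cnt-mono (BigEnds? M S) (Linked? X) linked T) ⟩
    length X ℕ.+ comp X ℕ.+ l               ≡⟨ ℕ.+-assoc (length X) (comp X) l ⟩
    length X ℕ.+ (comp X ℕ.+ l)             ≡⟨ cong (length X ℕ.+_) (ℕ.+-comm (comp X) l) ⟩
    length X ℕ.+ (l ℕ.+ comp X)             ≤⟨ ℕ.+-monoʳ-≤ (length X) (linked+comp X T) ⟩
    -- The hub has served its purpose: taking its edges away again can only raise the number of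
    -- components.
    length X ℕ.+ (length T ℕ.+ comp (T ++ X)) ≤⟨ ℕ.+-monoʳ-≤ (length X) (ℕ.+-monoʳ-≤ (length T) (comp-antitone {T ++ S} {T ++ X} (Conn-mono (⊆.++⁺ʳ T (⊆.xs⊆ys++xs S hub))))) ⟩
    length X ℕ.+ (length T ℕ.+ c)           ≡⟨ cong (ℕ._+ (length T ℕ.+ c)) (trans (List.length-++ hub) (cong (ℕ._+ length S) (List.length-map (z ,_) (bigRoots M S)))) ⟩
    r ℕ.+ length S ℕ.+ (length T ℕ.+ c)     ≡⟨ eq r (length S) (length T) c ⟩
    length T ℕ.+ length S ℕ.+ c ℕ.+ r       ≡⟨ cong (λ t → t ℕ.+ c ℕ.+ r) (List.length-++ T) ⟨
    length (T ++ S) ℕ.+ c ℕ.+ r             ∎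
    where
    open ℕ.≤-Reasoning
    -- The pairs may lie outside the host graph, be oriented either way, or include the loop at `z`.
    -- Each still costs one in `length` and lowers `comp` by at most one.
    hub = map (z ,_) (bigRoots M S)
    X = hub ++ S
    b = cnt (BigEnds? M S) T
    l = cnt (Linked? X) T
    c = comp (T ++ S)
    r = length (bigRoots M S)
    eq : ∀ r s t c → r ℕ.+ s ℕ.+ (t ℕ.+ c) ≡ t ℕ.+ s ℕ.+ c ℕ.+ r
    eq = solve 4 (λ r s t c → r :+ s :+ (t :+ c) := t :+ s :+ c :+ r) refl
      where open ℕ.+-*-Solver
    toHub : ∀ {u} → Big M S u → Conn X u z
    toHub {u} big with w , least , uw ← least-of S u = Conn-trans X (Conn-mono (⊆.xs⊆ys++xs S hub) uw)
      (Conn-sym X (Conn-edge (∈-++⁺ˡ (∈-map⁺ (z ,_) (∈-filter⁺ (λ v → Least? S v ×-dec Big? M S v) (∈-allFin w)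
        (least , ℕ.≤-trans big (cnt-mono (Conn? S u) (Conn? S w) (λ _ → Conn-trans S (Conn-sym S uw)) (allFin n))))))))
    linked : ∀ e → BigEnds M S e → Linked X e
    linked (u , v) (bu , bv) = Conn-trans X (toHub bu) (Conn-sym X (toHub bv))

-- Exploring components of the random subgraph

Unique-Sublist : ∀ {A : Set} {xs ys : List A} → Sublist xs ys → Unique ys → Unique xs
Unique-Sublist []         _           = []
Unique-Sublist (y ∷ʳ s)   (_ ∷ u)     = Unique-Sublist s u
Unique-Sublist (refl ∷ s) (y≢ ∷ u)    = Sublist.All-resp-⊆ s y≢ ∷ Unique-Sublist s u

module _ {n : ℕ} where

  open DecMembership (Fin._≟_ {n}) using (_∈?_)

  -- Turns a pair into the orientation in which `edges` lists it, so that a star can be revealed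
  -- from either end of an edge.
  edge : Fin n → Fin n → Edge n
  edge u v with u <? v
  ... | yes _ = u , v
  ... | no  _ = v , u

  edge-ends : ∀ u v → edge u v ≡ (u , v) ⊎ edge u v ≡ (v , u)
  edge-ends u v with u <? v
  ... | yes _ = inj₁ refl
  ... | no  _ = inj₂ refl

  edge-injective : ∀ a {u v} → edge a u ≡ edge a v → u ≡ v
  edge-injective a {u} {v} eq with edge a u | edge a v | edge-ends a u | edge-ends a v
  edge-injective a refl | _ | _ | inj₁ refl | inj₁ refl = refl
  edge-injective a refl | _ | _ | inj₁ refl | inj₂ refl = refl
  edge-injective a refl | _ | _ | inj₂ refl | inj₁ refl = refl
  edge-injective a refl | _ | _ | inj₂ refl | inj₂ refl = refl

  Conn-edge′ : ∀ {S u v} → edge u v ∈ S → Conn S u v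
  Conn-edge′ {S} {u} {v} e∈ with edge u v | edge-ends u v
  ... | _ | inj₁ refl = Conn-edge e∈
  ... | _ | inj₂ refl = Conn-sym S (Conn-edge e∈)

  Touches : Fin n → Edge n → Set
  Touches a (x , y) = x ≡ a ⊎ y ≡ a

  Touches? : ∀ a e → Dec (Touches a e)
  Touches? a (x , y) = x Fin.≟ a ⊎-dec y Fin.≟ a

  edge-touches : ∀ a y → Touches a (edge a y)
  edge-touches a y with edge a y | edge-ends a y
  ... | _ | inj₁ refl = inj₁ refl
  ... | _ | inj₂ refl = inj₂ refl

  edge-avoids : ∀ {a u v} → u ≢ a → v ≢ a → ¬ Touches a (edge u v)
  edge-avoids {a} {u} {v} u≢ v≢ t with edge u v | edge-ends u v | t
  ... | _ | inj₁ refl | inj₁ u≡ = u≢ u≡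
  ... | _ | inj₁ refl | inj₂ v≡ = v≢ v≡
  ... | _ | inj₂ refl | inj₁ v≡ = v≢ v≡
  ... | _ | inj₂ refl | inj₂ u≡ = u≢ u≡

  -- Minimality of `Conn` against the equivalence "both equal to `a` or neither", which every edge
  -- avoiding `a` respects.
  Conn-isolated : ∀ {S a} → (∀ {e} → e ∈ S → ¬ Touches a e) → ∀ {u} → Conn S u a → u ≡ a
  Conn-isolated {S} {a} iso c = proj₂ (Conn-minimal S {λ u v → (u ≡ a → v ≡ a) × (v ≡ a → u ≡ a)}
    (id , id) Product.swap (λ (f , g) (f′ , g′) → f′ ∘ f , g ∘ g′)
    (λ e∈ → (λ x≡a → contradiction (inj₁ x≡a) (iso e∈)) , (λ y≡a → contradiction (inj₂ y≡a) (iso e∈))) c) refl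

  Reached : List (Edge n) → List (Fin n) → Fin n → Set
  Reached S A u = Any (λ a → Conn S a u) A

  Reached? : ∀ S A u → Dec (Reached S A u)
  Reached? S A u = Any.any? (λ a → Conn? S a u) A

  size : List (Edge n) → List (Fin n) → ℕ
  size S A = cnt (Reached? S A) (allFin n)

  size-mono : ∀ {S T} A → S ⊆ T → size S A ℕ.≤ size T A
  size-mono {S} {T} A S⊆T = cnt-mono (Reached? S A) (Reached? T A) (λ _ → Any.map (Conn-mono S⊆T)) (allFin n)

  length≤size : ∀ S {A} → Unique A → length A ℕ.≤ size S A
  length≤size S {A} uA = Unique-⊆⇒length≤ uA
    (λ {x} x∈A → ∈-filter⁺ (Reached? S A) (∈-allFin x) (Any.map (λ { refl → Conn-refl S }) x∈A))

  -- The vertex a accounts for the suc: it is isolated in T.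
  size-explore : ∀ {S T a A N} → (∀ {y} → y ∈ N → edge a y ∈ S) → T ⊆ S →
    (∀ {e} → e ∈ T → ¬ Touches a e) → a ∉ N ++ A → suc (size T (N ++ A)) ℕ.≤ size S (a ∷ A)
  size-explore {S} {T} {a} {A} {N} star T⊆S avoid a∉ =
    Unique-⊆⇒length≤ {ys = a ∷ filter (Reached? T (N ++ A)) (allFin n)}
      (All.tabulate (λ z∈ a≡z → a-new (subst (Reached T (N ++ A)) (≡.sym a≡z) (proj₂ (∈-filter⁻ (Reached? T (N ++ A)) {xs = allFin n} z∈))))
         ∷ Unique.filter⁺ (Reached? T (N ++ A)) (Unique.allFin⁺ n))
      λ { (here refl) → ∈-filter⁺ (Reached? S (a ∷ A)) (∈-allFin a) (here (Conn-refl S))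
        ; {z} (there z∈) → ∈-filter⁺ (Reached? S (a ∷ A)) (∈-allFin z)
            (reach (Any.++⁻ N (proj₂ (∈-filter⁻ (Reached? T (N ++ A)) {xs = allFin n} z∈)))) }
    where
    a-new : ¬ Reached T (N ++ A) a
    a-new r = a∉ (Any.map (≡.sym ∘ Conn-isolated avoid) r)
    reach : ∀ {z} → Reached T N z ⊎ Reached T A z → Reached S (a ∷ A) z
    reach (inj₂ r) = there (Any.map (Conn-mono T⊆S) r)
    reach (inj₁ r) = here (via star r)
      where
      via : ∀ {N z} → (∀ {y} → y ∈ N → edge a y ∈ S) → Reached T N z → Conn S a z
      via st (here c)  = Conn-trans S (Conn-edge′ (st (here refl))) (Conn-mono T⊆S c)
      via st (there r) = via (st ∘ there) r

  -- The edge list of a graph, and the exploration star by star.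

  module _ (G : Graph n) where

    pair∈edges : ∀ {u v} → u <ᶠ v → adj G u v ≡ true → (u , v) ∈ edges G
    pair∈edges {u} {v} u<v uv = ∈-concatMap⁺ later {allFin n}
      (lose (∈-allFin u) (∈-map⁺ (u ,_) (∈-filter⁺ (λ j → (⌊ u <? j ⌋ ∧ adj G u j) Bool.≟ true) (∈-allFin v) later-uv)))
      where
      later : Fin n → List (Edge n)
      later i = map (i ,_) (filter (λ j → (⌊ i <? j ⌋ ∧ adj G i j) Bool.≟ true) (allFin n))
      later-uv : (⌊ u <? v ⌋ ∧ adj G u v) ≡ true
      later-uv with u <? v
      ... | yes _  = uv
      ... | no u≮v = contradiction u<v u≮v

    swapped∈edges : ∀ {u v} → ¬ u <ᶠ v → adj G u v ≡ true → (v , u) ∈ edges G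
    swapped∈edges {u} {v} u≮v uv with Fin.<-cmp u v
    ... | tri< u<v _ _  = contradiction u<v u≮v
    ... | tri≈ _ refl _ = contradiction (trans (≡.sym uv) (irrefl G u)) λ ()
    ... | tri> _ _ v<u  = pair∈edges v<u (trans (Graph.sym G v u) uv)

    edge∈edges : ∀ {u v} → adj G u v ≡ true → edge u v ∈ edges G
    edge∈edges {u} {v} uv with u <? v
    ... | yes u<v = pair∈edges u<v uv
    ... | no  u≮v = swapped∈edges u≮v uv

    -- The ordered adjacent pairs are distinct and number at least `n * k`; each of them is a listed
    -- edge or the reversal of one.
    handshake : ∀ {k} → MinDegreeAtLeast G k → n ℕ.* k ℕ.≤ 2 ℕ.* length (edges G)
    handshake {k} deg≥ = begin
      n ℕ.* k                                       ≡⟨ cong (ℕ._* k) (length-allFin n) ⟨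
      length (allFin n) ℕ.* k                       ≤⟨ length-concatMap≥ arcs {xs = allFin n} (λ {i} _ → ℕ.≤-trans (deg≥ i) (ℕ.≤-reflexive (≡.sym (List.length-map (i ,_) (nbrs i))))) ⟩
      length (concatMap arcs (allFin n))            ≤⟨ Unique-⊆⇒length≤ unique incl ⟩
      length (edges G ++ map Product.swap (edges G))        ≡⟨ List.length-++ (edges G) ⟩
      length (edges G) ℕ.+ length (map Product.swap (edges G)) ≡⟨ cong (length (edges G) ℕ.+_) (List.length-map Product.swap (edges G)) ⟩
      length (edges G) ℕ.+ length (edges G)         ≡⟨ cong (length (edges G) ℕ.+_) (ℕ.+-identityʳ (length (edges G))) ⟨
      2 ℕ.* length (edges G)                        ∎
      where
      open ℕ.≤-Reasoning
      nbrs : Fin n → List (Fin n)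
      nbrs i = filter (λ j → adj G i j Bool.≟ true) (allFin n)
      arcs : Fin n → List (Edge n)
      arcs i = map (i ,_) (nbrs i)
      arcs⁻ : ∀ i {e} → e ∈ arcs i → proj₁ e ≡ i × adj G (proj₁ e) (proj₂ e) ≡ true
      arcs⁻ i e∈ with j , j∈ , refl ← ∈-map⁻ (i ,_) e∈ = refl , proj₂ (∈-filter⁻ (λ j → adj G i j Bool.≟ true) {xs = allFin n} j∈)
      unique : Unique (concatMap arcs (allFin n))
      unique = Unique-concatMap arcs (Unique.allFin⁺ n)
        (λ i → Unique.map⁺ (λ { refl → refl }) (Unique.filter⁺ (λ j → adj G i j Bool.≟ true) (Unique.allFin⁺ n)))
        (λ {i} {j} _ _ e∈i e∈j → trans (≡.sym (proj₁ (arcs⁻ i e∈i))) (proj₁ (arcs⁻ j e∈j)))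
      incl : concatMap arcs (allFin n) ⊆ edges G ++ map Product.swap (edges G)
      incl {u , v} e∈ with i , e∈i ← Any.satisfied (∈-concatMap⁻ arcs {allFin n} e∈) with u <? v
      ... | yes u<v = ∈-++⁺ˡ (pair∈edges u<v (proj₂ (arcs⁻ i e∈i)))
      ... | no  u≮v = ∈-++⁺ʳ (edges G) (∈-map⁺ Product.swap (swapped∈edges u≮v (proj₂ (arcs⁻ i e∈i))))

    -- Reveal the star of one active vertex at a time. With r = 1 - δ, a revealed star
    -- multiplies the expectation of r ^ (number of active vertices) by at most
    -- (1 - p + p r) ^ m / r ≤ 1, so this potential bounds the probability of dying out early.
    module Exploration {p r : ℚ} (0≤p : 0ℚ ≤ p) (p≤1 : p ≤ 1ℚ) (0≤r : 0ℚ ≤ r) (r≤1 : r ≤ 1ℚ)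
      {M m k : ℕ} (m+M≤k : m ℕ.+ M ℕ.≤ k) (deg≥ : MinDegreeAtLeast G k) (small : pow (1ℚ - p + p * r) m ≤ r) where

      -- `D` holds the explored vertices and `H` the edges not yet revealed. The invariant is that
      -- every edge of `G` away from `D` is still in `H`.
      Covers : List (Edge n) → List (Fin n) → Set
      Covers H D = ∀ {u v} → adj G u v ≡ true → u ∉ D → v ∉ D → edge u v ∈ H

      0≤q : 0ℚ ≤ 1ℚ - p + p * r
      0≤q = 0≤+ (≤⇒0≤- p≤1) (0≤* 0≤p 0≤r)

      q≤1 : 1ℚ - p + p * r ≤ 1ℚ
      q≤1 = ≤-by-gap (p * (1ℚ - r)) (0≤* 0≤p (≤⇒0≤- r≤1)) (eq p r)
        where
        eq : ∀ p r → 1ℚ ≡ 1ℚ - p + p * r + p * (1ℚ - r)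
        eq = solve 2 (λ p r → con 1ℚ := con 1ℚ :- p :+ p :* r :+ p :* (con 1ℚ :- r)) refl
          where open +-*-Solver

      New? : ∀ a A D y → Dec (adj G a y ≡ true × y ∉ A × y ∉ D)
      New? a A D y = adj G a y Bool.≟ true ×-dec ¬? (y ∈? A) ×-dec ¬? (y ∈? D)

      -- Of at least `m + M` neighbours, at most `M` are active or explored already, so at least `m`
      -- are fresh however the exploration has gone.
      many-new : ∀ a A D → length A ℕ.+ length D ℕ.≤ M → m ℕ.≤ length (filter (New? a A D) (allFin n))
      many-new a A D AD≤M = ℕ.+-cancelʳ-≤ M m (length N) (ℕ.≤-trans m+M≤k (ℕ.≤-trans (deg≥ a)
        (ℕ.≤-trans (Unique-⊆⇒length≤ {xs = N ++ A ++ D} (Unique.filter⁺ nbr? (Unique.allFin⁺ n)) incl)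
          (ℕ.≤-trans (ℕ.≤-reflexive (trans (List.length-++ N) (cong (length N ℕ.+_) (List.length-++ A)))) (ℕ.+-monoʳ-≤ (length N) AD≤M)))))
        where
        N = filter (New? a A D) (allFin n)
        nbr? : ∀ y → Dec (adj G a y ≡ true)
        nbr? y = adj G a y Bool.≟ true
        incl : filter nbr? (allFin n) ⊆ N ++ A ++ D
        incl {y} y∈ with y ∈? A | y ∈? D
        ... | yes y∈A | _       = ∈-++⁺ʳ N (∈-++⁺ˡ y∈A)
        ... | no _    | yes y∈D = ∈-++⁺ʳ N (∈-++⁺ʳ A y∈D)
        ... | no y∉A  | no y∉D  = ∈-++⁺ˡ (∈-filter⁺ (New? a A D) (∈-allFin y) (proj₂ (∈-filter⁻ nbr? {xs = allFin n} y∈) , y∉A , y∉D))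

      -- Induction on `t`, the number of vertices still to be found. Exploring an active vertex `a`
      -- moves it to `D` and lowers `t` by one, which preserves `length D + t ≤ M`. The vertices
      -- found in its star join `A`.
      die-out : ∀ t A D H → Unique A → (∀ {a} → a ∈ A → a ∉ D) → length D ℕ.+ t ℕ.≤ M → Covers H D →
        𝔼 p H (λ S → ind (size S A ℕ.<? t)) ≤ pow r (length A)
      die-out zero A D H uA A∉D D≤M cov = begin
        𝔼 p H (λ S → ind (size S A ℕ.<? 0)) ≡⟨ 𝔼-cong p H (λ S → ind-false (size S A ℕ.<? 0) λ ()) ⟩
        𝔼 p H (λ S → 0ℚ)                    ≡⟨ 𝔼-const p H 0ℚ ⟩
        0ℚ                                  ≤⟨ 0≤pow 0≤r (length A) ⟩
        pow r (length A)                    ∎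
        where open ≤-Reasoning
      -- The process has died: the potential is `pow r 0`, which is 1, and bounds any probability.
      die-out (suc t) [] D H uA A∉D D≤M cov = begin
        𝔼 p H (λ S → ind (size S [] ℕ.<? suc t)) ≤⟨ 𝔼-mono 0≤p p≤1 H (λ S → ind≤1 (size S [] ℕ.<? suc t)) ⟩
        𝔼 p H (λ S → 1ℚ)                         ≡⟨ 𝔼-const p H 1ℚ ⟩
        1ℚ                                       ∎
        where open ≤-Reasoning
      die-out (suc t) (a ∷ A) D H uA@(a≢ ∷ uA′) A∉D D≤M cov with suc t ℕ.≤? length (a ∷ A)
      -- With `suc t` active vertices the event is impossible. In the other case active and explored
      -- vertices together number at most `M`, as `many-new` requires.
      ... | yes t<A = begin
        𝔼 p H (λ S → ind (size S (a ∷ A) ℕ.<? suc t))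
          ≡⟨ 𝔼-cong p H (λ S → ind-false (size S (a ∷ A) ℕ.<? suc t) (ℕ.≤⇒≯ (ℕ.≤-trans t<A (length≤size S uA)))) ⟩
        𝔼 p H (λ S → 0ℚ)                    ≡⟨ 𝔼-const p H 0ℚ ⟩
        0ℚ                                  ≤⟨ 0≤pow 0≤r (length (a ∷ A)) ⟩
        pow r (length (a ∷ A))              ∎
        where open ≤-Reasoning
      ... | no t≮A = begin
        𝔼 p H F
          -- Edges at `a` beyond those to its fresh neighbours `N` are discarded, which can only
          -- make a small component likelier. What remains splits into independent parts: the star
          -- and `H′`, where `a` is isolated.
          ≤⟨ 𝔼-antitone-drop 0≤p p≤1 {ys = map (edge a) N ++ H′} F-antitone H↭ ⟩
        𝔼 p (map (edge a) N ++ H′) F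
          ≡⟨ 𝔼-++ p (map (edge a) N) H′ F ⟩
        𝔼 p (map (edge a) N) (λ S → 𝔼 p H′ (λ T → F (S ++ T)))
          ≡⟨ 𝔼-map p (edge a) N (λ S → 𝔼 p H′ (λ T → F (S ++ T))) ⟩
        𝔼 p N (λ S → 𝔼 p H′ (λ T → F (map (edge a) S ++ T)))
          ≤⟨ 𝔼-mono-Sublist 0≤p p≤1 N (λ {S} S≤N → ≤-trans
               (𝔼-mono-Sublist 0≤p p≤1 H′ (λ {T} T≤H′ → explored S≤N T≤H′))
               (die-out t (S ++ A) (a ∷ D) H′ (unique S≤N) (alive S≤N)
                 (ℕ.≤-trans (ℕ.≤-reflexive (≡.sym (ℕ.+-suc (length D) t))) D≤M) cov′)) ⟩
        𝔼 p N (λ S → pow r (length (S ++ A)))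
          ≡⟨ 𝔼-cong p N (λ S → trans (cong (pow r) (trans (List.length-++ S) (ℕ.+-comm (length S) (length A)))) (pow-+ r (length A) (length S))) ⟩
        𝔼 p N (λ S → pow r (length A) * pow r (length S))
          ≡⟨ 𝔼-* p N (pow r (length A)) (pow r ∘ length) ⟩
        pow r (length A) * 𝔼 p N (pow r ∘ length)
          ≡⟨ cong (pow r (length A) *_) (𝔼-pow-length p r N) ⟩
        pow r (length A) * pow (1ℚ - p + p * r) (length N)
          ≤⟨ *-monoˡ (0≤pow 0≤r (length A)) (≤-trans (pow-antitone 0≤q q≤1 (many-new a (a ∷ A) D AD≤M)) small) ⟩
        pow r (length A) * r
          ≡⟨ ℚ.*-comm (pow r (length A)) r ⟩
        pow r (length (a ∷ A)) ∎
        where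
        open ≤-Reasoning
        F : List (Edge n) → ℚ
        F S = ind (size S (a ∷ A) ℕ.<? suc t)
        F-antitone : Antitone F
        F-antitone {S} {T} S⊆T = ind-mono (size T (a ∷ A) ℕ.<? suc t) (size S (a ∷ A) ℕ.<? suc t) (ℕ.≤-<-trans (size-mono (a ∷ A) S⊆T))
        N = filter (New? a (a ∷ A) D) (allFin n)
        N⁻ : ∀ {y} → y ∈ N → adj G a y ≡ true × y ∉ a ∷ A × y ∉ D
        N⁻ y∈ = proj₂ (∈-filter⁻ (New? a (a ∷ A) D) {xs = allFin n} y∈)
        uN : Unique N
        uN = Unique.filter⁺ (New? a (a ∷ A) D) (Unique.allFin⁺ n)
        H′ = filter (¬? ∘ Touches? a) H
        AD≤M : length (a ∷ A) ℕ.+ length D ℕ.≤ M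
        AD≤M = ℕ.≤-trans (ℕ.≤-reflexive (ℕ.+-comm (length (a ∷ A)) (length D)))
          (ℕ.≤-trans (ℕ.+-monoʳ-≤ (length D) (ℕ.<⇒≤ (ℕ.≰⇒> t≮A))) D≤M)
        a∉D = A∉D (here refl)
        star : ∃[ zs ] filter (Touches? a) H ↭ map (edge a) N ++ zs
        star = Unique-⊆⇒↭ (Unique.map⁺ (edge-injective a) uN) incl
          where
          incl : map (edge a) N ⊆ filter (Touches? a) H
          incl e∈ with y , y∈ , refl ← ∈-map⁻ (edge a) e∈ with ay , _ , y∉D ← N⁻ y∈ =
            ∈-filter⁺ (Touches? a) (cov ay a∉D y∉D) (edge-touches a y)
        H↭ : H ↭ (map (edge a) N ++ H′) ++ proj₁ star
        H↭ = ↭-trans (filter-complement-↭ (Touches? a) H)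
          (↭-trans (↭.++⁺ʳ H′ (proj₂ star))
          (↭-trans (↭-reflexive (List.++-assoc (map (edge a) N) (proj₁ star) H′))
          (↭-trans (↭.++⁺ˡ (map (edge a) N) (↭.++-comm (proj₁ star) H′))
                   (↭-reflexive (≡.sym (List.++-assoc (map (edge a) N) H′ (proj₁ star)))))))
        cov′ : Covers H′ (a ∷ D)
        cov′ uv u∉ v∉ = ∈-filter⁺ (¬? ∘ Touches? a) (cov uv (u∉ ∘ there) (v∉ ∘ there)) (edge-avoids (u∉ ∘ here) (v∉ ∘ here))
        module _ {S} (S≤N : Sublist S N) where
          S⊆N : S ⊆ N
          S⊆N = Sublist.Any-resp-⊆ S≤N
          unique : Unique (S ++ A)
          unique = Unique.++⁺ (Unique-Sublist S≤N uN) uA′ (λ (x∈S , x∈A) → proj₁ (proj₂ (N⁻ (S⊆N x∈S))) (there x∈A))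
          alive : ∀ {x} → x ∈ S ++ A → x ∉ a ∷ D
          alive x∈ x∈′ with ∈-++⁻ S x∈ | x∈′
          ... | inj₁ x∈S | here refl = proj₁ (proj₂ (N⁻ (S⊆N x∈S))) (here refl)
          ... | inj₁ x∈S | there x∈D = proj₂ (proj₂ (N⁻ (S⊆N x∈S))) x∈D
          ... | inj₂ x∈A | here refl = All.lookup a≢ x∈A refl
          ... | inj₂ x∈A | there x∈D = A∉D (there x∈A) x∈D
          explored : ∀ {T} → Sublist T H′ → F (map (edge a) S ++ T) ≤ ind (size T (S ++ A) ℕ.<? t)
          explored {T} T≤H′ = ind-mono (size (map (edge a) S ++ T) (a ∷ A) ℕ.<? suc t) (size T (S ++ A) ℕ.<? t)
            (λ lt → ℕ.≤-pred (ℕ.≤-trans (ℕ.s≤s (size-explore {N = S} (λ y∈ → ∈-++⁺ˡ (∈-map⁺ (edge a) y∈)) (⊆.xs⊆ys++xs T (map (edge a) S))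
              (λ e∈ → proj₂ (∈-filter⁻ (¬? ∘ Touches? a) {xs = H} (Sublist.Any-resp-⊆ T≤H′ e∈)))
              (λ a∈ → alive a∈ (here refl)))) lt))

-- Two-round exposure

ind-× : ∀ {P Q : Set} (P? : Dec P) (Q? : Dec Q) → ind P? * ind Q? ≤ ind (P? ×-dec Q?)
ind-× (yes _) (yes _) = ≤-reflexive (ℚ.*-identityˡ 1ℚ)
ind-× (yes _) (no _)  = ≤-reflexive (ℚ.*-identityˡ 0ℚ)
ind-× (no _)  Q?      = ≤-reflexive (ℚ.*-zeroˡ (ind Q?))

∑-ind : ∀ {A : Set} {P : A → Set} (P? : Decidable P) xs → ∑ xs (ind ∘ P?) ≡ ℕtoℚ (cnt P? xs)
∑-ind P? []       = refl
∑-ind P? (x ∷ xs) with P? x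
... | yes _ = trans (cong (1ℚ +_) (∑-ind P? xs)) (≡.sym (ℕtoℚ-suc (cnt P? xs)))
... | no _  = trans (ℚ.+-identityˡ (∑ xs (ind ∘ P?))) (∑-ind P? xs)

module TwoRounds {n : ℕ} (z : Fin n) (G : Graph n) {p r : ℚ} (0≤p : 0ℚ ≤ p) (p≤1 : p ≤ 1ℚ) (0≤r : 0ℚ ≤ r) (r≤1 : r ≤ 1ℚ)
  {M m k : ℕ} (m+M≤k : m ℕ.+ M ℕ.≤ k) (deg≥ : MinDegreeAtLeast G k) (small : pow (1ℚ - p + p * r) m ≤ r) where

  open Exploration G 0≤p p≤1 0≤r r≤1 {M} m+M≤k deg≥ small

  big : Fin n → List (Edge n) → ℚ
  big v S = ind (Big? M S v)

  big-isotone : ∀ v → Isotone (big v)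
  big-isotone v {S} {T} S⊆T = ind-mono (Big? M S v) (Big? M T v) (Big-mono {S = S} S⊆T)

  -- The exploration starts with `v` alone active and nothing explored, so the potential is `r`
  -- itself. `M` enters only through `m + M ≤ k`, not through the bound.
  big-likely : ∀ v → 1ℚ - r ≤ 𝔼 p (edges G) (big v)
  big-likely v = ≤-by-gap (b + r - 1ℚ) (≤⇒0≤- 1≤) (eq b r)
    where
    open ≤-Reasoning
    b = 𝔼 p (edges G) (big v)
    dead : List (Edge n) → ℚ
    dead S = ind (size S [ v ] ℕ.<? M)
    eq : ∀ b r → b ≡ 1ℚ - r + (b + r - 1ℚ)
    eq = solve 2 (λ b r → b := con 1ℚ :- r :+ (b :+ r :- con 1ℚ)) refl
      where open +-*-Solver
    covered : ∀ S → 1ℚ ≤ big v S + dead S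
    covered S with size S [ v ] ℕ.<? M
    ... | yes _   = ℚ.+-monoˡ-≤ 1ℚ (0≤ind (Big? M S v))
    ... | no  s≮M = ≤-reflexive (≡.sym (trans (ℚ.+-identityʳ (big v S)) (ind-true (Big? M S v)
                      (ℕ.≤-trans (ℕ.≮⇒≥ s≮M) (cnt-mono (Reached? S [ v ]) (Conn? S v) (λ { _ (here c) → c }) (allFin n))))))
    1≤ : 1ℚ ≤ b + r
    1≤ = begin
      1ℚ                                      ≡⟨ 𝔼-const p (edges G) 1ℚ ⟨
      𝔼 p (edges G) (λ _ → 1ℚ)                ≤⟨ 𝔼-mono 0≤p p≤1 (edges G) covered ⟩
      𝔼 p (edges G) (λ S → big v S + dead S)  ≡⟨ 𝔼-+ p (edges G) (big v) dead ⟩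
      b + 𝔼 p (edges G) dead                  ≤⟨ ℚ.+-monoʳ-≤ b (die-out M [ v ] [] (edges G) ([] ∷ []) (λ _ ()) ℕ.≤-refl (λ uv _ _ → edge∈edges G uv)) ⟩
      b + r * 1ℚ                              ≡⟨ cong (b +_) (ℚ.*-identityʳ r) ⟩
      b + r                                   ∎

  bigEnds : List (Edge n) → Edge n → ℚ
  bigEnds S e = ind (BigEnds? M S e)

  bigEnds-likely : ∀ e → (1ℚ - r) * (1ℚ - r) ≤ 𝔼 p (edges G) (λ S → bigEnds S e)
  bigEnds-likely (u , v) = begin
    (1ℚ - r) * (1ℚ - r)                               ≤⟨ *-mono 0≤δ (≤-trans 0≤δ (big-likely v)) (big-likely u) (big-likely v) ⟩
    𝔼 p (edges G) (big u) * 𝔼 p (edges G) (big v)     ≤⟨ harris 0≤p p≤1 (edges G) (big-isotone u) (big-isotone v) ⟩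
    𝔼 p (edges G) (λ S → big u S * big v S)           ≤⟨ 𝔼-mono 0≤p p≤1 (edges G) (λ S → ind-× (Big? M S u) (Big? M S v)) ⟩
    𝔼 p (edges G) (λ S → bigEnds S (u , v))           ∎
    where
    open ≤-Reasoning
    0≤δ = ≤⇒0≤- r≤1

  module _ {q μ : ℚ} (0≤q : 0ℚ ≤ q) (q≤1 : q ≤ 1ℚ) (0≤μ : 0ℚ ≤ μ) (μM≡1 : μ * ℕtoℚ M ≡ 1ℚ) where

    -- This is `n / M`, the bound on the number of big components.
    β : ℚ
    β = μ * ℕtoℚ n

    -- `exc` with `comp` in place of `components`. `𝔼-sprinkle` asks for invariance under
    -- reordering, which for `comp` follows from monotonicity of `Conn`.
    exc′ : List (Edge n) → ℚ
    exc′ S = (ℕtoℚ (length S) - ℕtoℚ n) + ℕtoℚ (comp S)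

    exc′-invariant : ↭-Invariant exc′
    exc′-invariant {S} {T} S↭T = cong₂ (λ l c → (ℕtoℚ l - ℕtoℚ n) + ℕtoℚ c) (↭-length S↭T)
      (ℕ.≤-antisym (comp-antitone {S = T} {T = S} (Conn-mono (∈-resp-↭ (↭-sym S↭T)))) (comp-antitone {S = S} {T = T} (Conn-mono (∈-resp-↭ S↭T))))

    bigRoots≤β : ∀ (S : List (Edge n)) → ℕtoℚ (length (bigRoots M S)) ≤ β
    bigRoots≤β S = begin
      R                  ≡⟨ ℚ.*-identityˡ R ⟨
      1ℚ * R             ≡⟨ cong (_* R) μM≡1 ⟨
      μ * ℕtoℚ M * R     ≡⟨ eq μ (ℕtoℚ M) R ⟩
      μ * (R * ℕtoℚ M)   ≡⟨ cong (μ *_) (ℕtoℚ-* (length (bigRoots M S)) M) ⟨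
      μ * ℕtoℚ (length (bigRoots M S) ℕ.* M) ≤⟨ *-monoˡ 0≤μ (ℕtoℚ-mono {length (bigRoots M S) ℕ.* M} {n} (bigRoots-few M S)) ⟩
      β                  ∎
      where
      open ≤-Reasoning
      R = ℕtoℚ (length (bigRoots M S))
      eq : ∀ a b c → a * b * c ≡ a * (c * b)
      eq = solve 3 (λ a b c → a :* b :* c := a :* (c :* b)) refl
        where open +-*-Solver

    exc′-bound : ∀ (S T : List (Edge n)) → ∑ T (bigEnds S) - β ≤ exc′ (T ++ S)
    exc′-bound S T = ≤-by-gap ((l + c + R - (N + b)) + (β - R))
      (0≤+ (≤⇒0≤- bound) (≤⇒0≤- (bigRoots≤β S)))
      (trans (eq l c R N b β) (cong (λ t → t - β + ((l + c + R - (N + b)) + (β - R))) (≡.sym (∑-ind (BigEnds? M S) T))))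
      where
      l = ℕtoℚ (length (T ++ S))
      c = ℕtoℚ (comp (T ++ S))
      R = ℕtoℚ (length (bigRoots M S))
      N = ℕtoℚ n
      b = ℕtoℚ (cnt (BigEnds? M S) T)
      bound : N + b ≤ l + c + R
      bound = subst₂ _≤_ (ℕtoℚ-+ n (cnt (BigEnds? M S) T))
        (trans (ℕtoℚ-+ (length (T ++ S) ℕ.+ comp (T ++ S)) (length (bigRoots M S))) (cong (_+ R) (ℕtoℚ-+ (length (T ++ S)) (comp (T ++ S)))))
        (ℕtoℚ-mono {n ℕ.+ cnt (BigEnds? M S) T} {length (T ++ S) ℕ.+ comp (T ++ S) ℕ.+ length (bigRoots M S)} (excess-bound z M S T))
      eq : ∀ l c R N b β → l - N + c ≡ b - β + ((l + c + R - (N + b)) + (β - R))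
      eq = solve 6 (λ l c R N b β → l :- N :+ c := b :- β :+ ((l :+ c :+ R :- (N :+ b)) :+ (β :- R))) refl
        where open +-*-Solver

    L : ℚ
    L = ℕtoℚ (length (edges G))

    -- The gain is a sum over `U`, the edges missed by the first round, and whether an edge is
    -- missed depends on the same `S` as whether its ends are big. So the sum over `U` is replaced
    -- by the sum over all edges minus one for every edge of `S`; this costs `p * L` on average.
    expectedExc-bound : q * (L * ((1ℚ - r) * (1ℚ - r)) - p * L) - β ≤ expectedExc G (p + (1ℚ - p) * q)
    expectedExc-bound = begin
      q * (L * ((1ℚ - r) * (1ℚ - r)) - p * L) - β
        ≡⟨ cong (λ t → q * (t - p * L) - β) (∑-const E ((1ℚ - r) * (1ℚ - r))) ⟨
      q * (∑ E (λ _ → (1ℚ - r) * (1ℚ - r)) - p * L) - β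
        ≤⟨ ℚ.+-monoˡ-≤ (- β) (*-monoˡ 0≤q (ℚ.+-monoˡ-≤ (- (p * L)) (∑-mono E bigEnds-likely))) ⟩
      q * (∑ E (λ e → 𝔼 p E (λ S → bigEnds S e)) - p * L) - β
        ≡⟨ cong₂ (λ s t → q * (s - p * t) - β) (𝔼-∑-swap p E E (λ e S → bigEnds S e)) (trans (∑-const E 1ℚ) (ℚ.*-identityʳ L)) ⟨
      q * (𝔼 p E (λ S → ∑ E (bigEnds S)) - p * ∑ E (λ _ → 1ℚ)) - β
        ≡⟨ cong (λ t → q * (𝔼 p E (λ S → ∑ E (bigEnds S)) - t) - β) (𝔼-∑-subset p E (λ _ → 1ℚ)) ⟨
      q * (𝔼 p E (λ S → ∑ E (bigEnds S)) - 𝔼 p E ∣_∣) - β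
        ≡⟨ linear ⟨
      𝔼 p E (λ S → q * (∑ E (bigEnds S) + - 1ℚ * ∣ S ∣) + - β)
        ≡⟨ 𝔼₂-forget p E (λ S → q * (∑ E (bigEnds S) + - 1ℚ * ∣ S ∣) + - β) ⟨
      𝔼₂ p E (λ S U → q * (∑ E (bigEnds S) + - 1ℚ * ∣ S ∣) + - β)
        ≤⟨ 𝔼₂-mono 0≤p p≤1 E (λ S U SU↭E → ℚ.+-monoˡ-≤ (- β) (*-monoˡ 0≤q (unused S U SU↭E))) ⟩
      𝔼₂ p E (λ S U → q * ∑ U (bigEnds S) + - β)
        ≡⟨ 𝔼₂-cong p E (λ S U → cong₂ _+_ (𝔼-∑-subset q U (bigEnds S)) (𝔼-const q U (- β))) ⟨
      𝔼₂ p E (λ S U → 𝔼 q U (λ T → ∑ T (bigEnds S)) + 𝔼 q U (λ T → - β))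
        ≡⟨ 𝔼₂-cong p E (λ S U → 𝔼-+ q U (λ T → ∑ T (bigEnds S)) (λ T → - β)) ⟨
      𝔼₂ p E (λ S U → 𝔼 q U (λ T → ∑ T (bigEnds S) - β))
        ≤⟨ 𝔼₂-mono 0≤p p≤1 E (λ S U _ → 𝔼-mono 0≤q q≤1 U (exc′-bound S)) ⟩
      𝔼₂ p E (λ S U → 𝔼 q U (λ T → exc′ (T ++ S)))
        ≡⟨ 𝔼-sprinkle p q E exc′-invariant ⟨
      𝔼 s E exc′
        ≤⟨ 𝔼-mono 0≤s s≤1 E (λ S → ℚ.+-monoʳ-≤ (ℕtoℚ (length S) - ℕtoℚ n) (ℕtoℚ-mono {comp S} {components S} (comp≤components S))) ⟩
      𝔼 s E exc
        ≡⟨ weightedSum≡𝔼 s E exc ⟨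
      expectedExc G s ∎
      where
      open ≤-Reasoning
      s = p + (1ℚ - p) * q
      E = edges G
      ∣_∣ : List (Edge n) → ℚ
      -- The size written as a sum, so that `𝔼-∑-subset` gives its mean and `∑-mono` compares it
      -- with the sum of `bigEnds`.
      ∣ S ∣ = ∑ S (λ _ → 1ℚ)
      0≤s : 0ℚ ≤ s
      0≤s = 0≤+ 0≤p (0≤* (≤⇒0≤- p≤1) 0≤q)
      s≤1 : s ≤ 1ℚ
      s≤1 = ≤-by-gap ((1ℚ - p) * (1ℚ - q)) (0≤* (≤⇒0≤- p≤1) (≤⇒0≤- q≤1)) (eq p q)
        where
        eq : ∀ p q → 1ℚ ≡ p + (1ℚ - p) * q + (1ℚ - p) * (1ℚ - q)
        eq = solve 2 (λ p q → con 1ℚ := p :+ (con 1ℚ :- p) :* q :+ (con 1ℚ :- p) :* (con 1ℚ :- q)) refl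
          where open +-*-Solver
      linear : 𝔼 p E (λ S → q * (∑ E (bigEnds S) + - 1ℚ * ∣ S ∣) + - β) ≡ q * (𝔼 p E (λ S → ∑ E (bigEnds S)) - 𝔼 p E ∣_∣) - β
      linear = trans (𝔼-+ p E (λ S → q * (∑ E (bigEnds S) + - 1ℚ * ∣ S ∣)) (λ _ → - β))
        (cong₂ _+_ (trans (𝔼-* p E q (λ S → ∑ E (bigEnds S) + - 1ℚ * ∣ S ∣))
                          (cong (q *_) (trans (𝔼-+ p E (λ S → ∑ E (bigEnds S)) (λ S → - 1ℚ * ∣ S ∣))
                            (cong (𝔼 p E (λ S → ∑ E (bigEnds S)) +_) (trans (𝔼-* p E (- 1ℚ) ∣_∣) (neg (𝔼 p E ∣_∣)))))))
                   (𝔼-const p E (- β)))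
        where
        neg : ∀ x → - 1ℚ * x ≡ - x
        neg = solve 1 (λ x → con (- 1ℚ) :* x := :- x) refl
          where open +-*-Solver
      unused : ∀ S U → S ++ U ↭ E → ∑ E (bigEnds S) + - 1ℚ * ∣ S ∣ ≤ ∑ U (bigEnds S)
      unused S U SU↭E = ≤-by-gap (∣ S ∣ - a) (≤⇒0≤- (∑-mono S (λ e → ind≤1 (BigEnds? M S e))))
        (trans (eq a b ∣ S ∣) (cong (λ t → t + - 1ℚ * ∣ S ∣ + (∣ S ∣ - a)) (trans (≡.sym (∑-++ S U (bigEnds S))) (∑-↭ (bigEnds S) SU↭E))))
        where
        a = ∑ S (bigEnds S)
        b = ∑ U (bigEnds S)
        eq : ∀ a b t → b ≡ a + b + - 1ℚ * t + (t - a)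
        eq = solve 3 (λ a b t → b := a :+ b :+ con (- 1ℚ) :* t :+ (t :- a)) refl
          where open +-*-Solver

-- Choice of constants

-- The fraction `1 / suc m` as a literal in lowest terms, so that signs and comparisons can be read
-- off the constructor.
unitFraction : ℕ → ℚ
unitFraction m = mkℚ (ℤ.+ 1) m (1-coprimeTo (suc m))

0<unitFraction : ∀ m → 0ℚ < unitFraction m
0<unitFraction m = ℚ.positive⁻¹ (unitFraction m)

0≤unitFraction : ∀ m → 0ℚ ≤ unitFraction m
0≤unitFraction m = ℚ.<⇒≤ (0<unitFraction m)

unitFraction-inverse : ∀ m → unitFraction m * ℕtoℚ (suc m) ≡ 1ℚ
unitFraction-inverse m = trans (cong (unitFraction m *_) (ℚ.normalize-coprime c))
  (ℚ.*-inverseˡ (mkℚ (ℤ.+ suc m) 0 c))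
  where c = Coprimality.sym (1-coprimeTo (suc m))

unitFraction≤1 : ∀ m → unitFraction m ≤ 1ℚ
unitFraction≤1 m = *≤* (ℤ.+≤+ (ℕ.s≤s ℕ.z≤n))

-- The denominator of `ε` serves, because a positive numerator is at least one.
∃-unitFraction≤ : ∀ ε → 0ℚ < ε → ∃[ d ] unitFraction d ≤ ε
∃-unitFraction≤ (mkℚ (ℤ.+ zero)    d c) (*<* (ℤ.+<+ ()))
∃-unitFraction≤ (mkℚ (ℤ.+ suc m)   d c) _           = d , *≤* (ℤ.+≤+ (ℕ.*-monoˡ-≤ (suc d) {1} {suc m} (ℕ.s≤s ℕ.z≤n)))
∃-unitFraction≤ (mkℚ ℤ.-[1+ m ]    d c) (*<* ())

two four eight : ℚ
two   = ℕtoℚ 2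
four  = ℕtoℚ 4
eight = ℕtoℚ 8

-- The first-round density p₁ = (1 + 4 δ) / K leaves p - p₁ ≥ 4 δ / K for sprinkling, where 8 δ ≤ ε.
module FirstRound {δ a κ K Mq μ : ℚ} (0≤δ : 0ℚ ≤ δ) (8δ≤1 : eight * δ ≤ 1ℚ) (0≤κ : 0ℚ ≤ κ) (κK≡1 : κ * K ≡ 1ℚ)
  (μ≡½δ³ : μ ≡ ½ * (δ * δ * δ)) (μMq≡1 : μ * Mq ≡ 1ℚ) (δa≡1 : δ * a ≡ 1ℚ) (Mqa≤K : Mq * a ≤ K) where

  open +-*-Solver

  -- `w` is the slack in `8δ ≤ 1`. The gaps below are written with nonnegative factors and summands
  -- such as `w`, `δ` and `κ`, so that their sign is visible; for instance `w + 7δ` is `1 - δ`.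
  p₁ w : ℚ
  p₁ = (1ℚ + four * δ) * κ
  w  = 1ℚ - eight * δ

  0≤w : 0ℚ ≤ w
  0≤w = ≤⇒0≤- 8δ≤1

  0≤2 : 0ℚ ≤ two
  0≤2 = 0≤ℕtoℚ 2

  0≤4 : 0ℚ ≤ four
  0≤4 = 0≤ℕtoℚ 4

  0≤½ : 0ℚ ≤ ½
  0≤½ = ℚ.nonNegative⁻¹ ½

  0≤1+4δ : 0ℚ ≤ 1ℚ + four * δ
  0≤1+4δ = 0≤+ 0≤1 (0≤* 0≤4 0≤δ)

  0≤w+7δ : 0ℚ ≤ w + ℕtoℚ 7 * δ
  0≤w+7δ = 0≤+ 0≤w (0≤* (0≤ℕtoℚ 7) 0≤δ)

  0≤p₁ : 0ℚ ≤ p₁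
  0≤p₁ = 0≤* 0≤1+4δ 0≤κ

  δ≤1 : δ ≤ 1ℚ
  δ≤1 = ≤-by-gap (w + ℕtoℚ 7 * δ) 0≤w+7δ
    (solve 1 (λ δ → con 1ℚ := δ :+ (con 1ℚ :- con eight :* δ :+ con (ℕtoℚ 7) :* δ)) refl δ)

  -- This is `M/k ≤ δ`: setting aside `M` neighbours costs at most a fraction `δ` of the `k`
  -- guaranteed ones.
  κMq≤δ : κ * Mq ≤ δ
  κMq≤δ = begin
    κ * Mq              ≡⟨ ℚ.*-identityʳ (κ * Mq) ⟨
    κ * Mq * 1ℚ         ≡⟨ cong (κ * Mq *_) δa≡1 ⟨
    κ * Mq * (δ * a)    ≡⟨ solve 4 (λ κ m δ a → κ :* m :* (δ :* a) := κ :* δ :* (m :* a)) refl κ Mq δ a ⟩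
    κ * δ * (Mq * a)    ≤⟨ *-monoˡ (0≤* 0≤κ 0≤δ) Mqa≤K ⟩
    κ * δ * K           ≡⟨ solve 3 (λ κ δ k → κ :* δ :* k := κ :* k :* δ) refl κ δ K ⟩
    κ * K * δ           ≡⟨ cong (_* δ) κK≡1 ⟩
    1ℚ * δ              ≡⟨ ℚ.*-identityˡ δ ⟩
    δ                   ∎
    where open ≤-Reasoning

  0≤μ : 0ℚ ≤ μ
  0≤μ = ≤-trans (0≤* 0≤½ (0≤* (0≤* 0≤δ 0≤δ) 0≤δ)) (≤-reflexive (≡.sym μ≡½δ³))

  κ≤½δ⁴ : κ ≤ ½ * (δ * δ * δ) * δ
  κ≤½δ⁴ = begin
    κ                       ≡⟨ ℚ.*-identityʳ κ ⟨
    κ * 1ℚ                  ≡⟨ cong (κ *_) μMq≡1 ⟨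
    κ * (μ * Mq)            ≡⟨ solve 3 (λ κ μ m → κ :* (μ :* m) := μ :* (κ :* m)) refl κ μ Mq ⟩
    μ * (κ * Mq)            ≤⟨ *-monoˡ 0≤μ κMq≤δ ⟩
    μ * δ                   ≡⟨ cong (_* δ) μ≡½δ³ ⟩
    ½ * (δ * δ * δ) * δ     ∎
    where open ≤-Reasoning

  4κ≤δ² : four * κ ≤ δ * δ
  4κ≤δ² = ≤-by-gap (four * (½ * (δ * δ * δ) * δ - κ) + δ * δ * (w + two * δ * (ℕtoℚ 3 + (w + ℕtoℚ 7 * δ))))
    (0≤+ (0≤* 0≤4 (≤⇒0≤- κ≤½δ⁴)) (0≤* (0≤* 0≤δ 0≤δ) (0≤+ 0≤w (0≤* (0≤* 0≤2 0≤δ) (0≤+ (0≤ℕtoℚ 3) 0≤w+7δ)))))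
    (solve 2 (λ δ κ → let w = con 1ℚ :- con eight :* δ in
       δ :* δ := con four :* κ :+ (con four :* (con ½ :* (δ :* δ :* δ) :* δ :- κ) :+ δ :* δ :* (w :+ con two :* δ :* (con (ℕtoℚ 3) :+ (w :+ con (ℕtoℚ 7) :* δ))))) refl δ κ)

  -- Keeps the share of edges spent in the first round to half of `δ²`, the lower bound on the
  -- probability that both ends of an edge are big.
  p₁≤½δ² : p₁ ≤ ½ * (δ * δ)
  p₁≤½δ² = ≤-by-gap (½ * (δ * δ - four * κ) + κ * (w + four * δ))
    (0≤+ (0≤* 0≤½ (≤⇒0≤- 4κ≤δ²)) (0≤* 0≤κ (0≤+ 0≤w (0≤* 0≤4 0≤δ))))
    (solve 2 (λ δ κ → con ½ :* (δ :* δ) := (con 1ℚ :+ con four :* δ) :* κ :+ (con ½ :* (δ :* δ :- con four :* κ) :+ κ :* (con 1ℚ :- con eight :* δ :+ con four :* δ))) refl δ κ)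

  p₁≤½ : p₁ ≤ ½
  p₁≤½ = ≤-trans p₁≤½δ² (≤-trans (*-monoˡ 0≤½ (*-mono 0≤δ 0≤1 δ≤1 δ≤1)) (≤-reflexive (ℚ.*-identityʳ ½)))

  p₁≤1 : p₁ ≤ 1ℚ
  p₁≤1 = ≤-trans p₁≤½ (*≤* (ℤ.+≤+ (ℕ.s≤s ℕ.z≤n)))

  -- After cancelling, this says that `1 - δ` times the mean offspring `(K - Mq) * p₁` is at least
  -- 1. Since `κ * Mq ≤ δ`, that product is at least `(1 - δ)² (1 + 4δ)`, which is
  -- `1 + δ (2 - 7δ + 4δ²)`.
  supercritical : 1ℚ ≤ (1ℚ - δ) * (1ℚ + (K - Mq) * (p₁ * δ))
  supercritical = ≤-by-gap (δ * (δ * (w + 1ℚ + δ + four * (δ * δ)) + (δ - κ * Mq) * ((1ℚ + four * δ) * (w + ℕtoℚ 7 * δ))))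
    (0≤* 0≤δ (0≤+ (0≤* 0≤δ (0≤+ (0≤+ (0≤+ 0≤w 0≤1) 0≤δ) (0≤* 0≤4 (0≤* 0≤δ 0≤δ)))) (0≤* (≤⇒0≤- κMq≤δ) (0≤* 0≤1+4δ 0≤w+7δ))))
    (trans (solve 4 (λ δ κ k m → (con 1ℚ :- δ) :* (con 1ℚ :+ (k :- m) :* ((con 1ℚ :+ con four :* δ) :* κ :* δ))
                     := (con 1ℚ :- δ) :* (con 1ℚ :+ (κ :* k :- κ :* m) :* ((con 1ℚ :+ con four :* δ) :* δ))) refl δ κ K Mq)
    (trans (cong (λ t → (1ℚ - δ) * (1ℚ + (t - κ * Mq) * ((1ℚ + four * δ) * δ))) κK≡1)
           (solve 2 (λ δ g → let w = con 1ℚ :- con eight :* δ in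
             (con 1ℚ :- δ) :* (con 1ℚ :+ (con 1ℚ :- g) :* ((con 1ℚ :+ con four :* δ) :* δ))
             := con 1ℚ :+ δ :* (δ :* (w :+ con 1ℚ :+ δ :+ con four :* (δ :* δ)) :+ (δ :- g) :* ((con 1ℚ :+ con four :* δ) :* (w :+ con (ℕtoℚ 7) :* δ)))) refl δ (κ * Mq))))

  -- Supplies the hypothesis `small` of the exploration with `r = 1 - δ`. With `x = p₁ δ`, the bound
  -- is `(1 - x) ^ m ≤ 1 / (1 + m x) ≤ 1 - δ`; division is avoided by inserting the factor that
  -- `supercritical` shows to be at least 1.
  shrinks : ∀ m → ℕtoℚ m ≡ K - Mq → pow (1ℚ - p₁ + p₁ * (1ℚ - δ)) m ≤ 1ℚ - δ
  shrinks m m≡ = begin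
    pow (1ℚ - p₁ + p₁ * (1ℚ - δ)) m   ≡⟨ cong (λ t → pow t m) (solve 2 (λ p δ → con 1ℚ :- p :+ p :* (con 1ℚ :- δ) := con 1ℚ :- p :* δ) refl p₁ δ) ⟩
    P                                 ≡⟨ ℚ.*-identityʳ P ⟨
    P * 1ℚ                            ≤⟨ *-monoˡ (0≤pow (≤⇒0≤- x≤1) m) supercritical ⟩
    P * ((1ℚ - δ) * (1ℚ + (K - Mq) * x)) ≡⟨ cong (λ t → P * ((1ℚ - δ) * (1ℚ + t * x))) m≡ ⟨
    P * ((1ℚ - δ) * (1ℚ + ℕtoℚ m * x)) ≡⟨ solve 3 (λ P d y → P :* (d :* y) := d :* (P :* y)) refl P (1ℚ - δ) (1ℚ + ℕtoℚ m * x) ⟩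
    (1ℚ - δ) * (P * (1ℚ + ℕtoℚ m * x)) ≤⟨ *-monoˡ (≤⇒0≤- δ≤1) (pow-1-x (0≤* 0≤p₁ 0≤δ) x≤1 m) ⟩
    (1ℚ - δ) * 1ℚ                     ≡⟨ ℚ.*-identityʳ (1ℚ - δ) ⟩
    1ℚ - δ                            ∎
    where
    open ≤-Reasoning
    x = p₁ * δ
    P = pow (1ℚ - x) m
    x≤1 : x ≤ 1ℚ
    x≤1 = *-mono 0≤p₁ 0≤1 p₁≤1 δ≤1

  module _ {p ε : ℚ} (8δ≤ε : eight * δ ≤ ε) (p≤1 : p ≤ 1ℚ) (pK≥ : 1ℚ + ε ≤ p * K) where

    4δκ≤p-p₁ : four * δ * κ ≤ p - p₁
    4δκ≤p-p₁ = begin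
      four * δ * κ                          ≡⟨ solve 2 (λ δ κ → con four :* δ :* κ := (con 1ℚ :+ con eight :* δ) :* κ :- (con 1ℚ :+ con four :* δ) :* κ) refl δ κ ⟩
      (1ℚ + eight * δ) * κ - p₁             ≤⟨ ℚ.+-monoˡ-≤ (- p₁) (*-monoʳ 0≤κ (≤-trans (ℚ.+-monoʳ-≤ 1ℚ 8δ≤ε) pK≥)) ⟩
      p * K * κ - p₁                        ≡⟨ solve 4 (λ p k κ q → p :* k :* κ :- q := p :* (κ :* k) :- q) refl p K κ p₁ ⟩
      p * (κ * K) - p₁                      ≡⟨ cong (λ t → p * t - p₁) κK≡1 ⟩
      p * 1ℚ - p₁                           ≡⟨ cong (_- p₁) (ℚ.*-identityʳ p) ⟩
      p - p₁                                ∎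
      where open ≤-Reasoning

    -- `q` is `(p - p₁) / (1 - p₁)`, so that the two rounds compose to exactly `p`. Dividing by
    -- `1 - p₁ ≤ 1` can only enlarge the surplus `p - p₁`.
    second-round : ∃[ q ] (p₁ + (1ℚ - p₁) * q ≡ p × 0ℚ ≤ q × q ≤ 1ℚ × four * δ * κ ≤ q)
    second-round = q , p≡ , 0≤q , q≤1 , ≤-trans 4δκ≤p-p₁ p-p₁≤q
      where
      open ≤-Reasoning
      0<1-p₁ : 0ℚ < 1ℚ - p₁
      0<1-p₁ = ℚ.<-≤-trans (ℚ.positive⁻¹ ½) (≤-by-gap (½ - p₁) (≤⇒0≤- p₁≤½)
        (solve 1 (λ p → con 1ℚ :- p := con ½ :+ (con ½ :- p)) refl p₁))
      instance
        pos : Positive (1ℚ - p₁)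
        pos = positive 0<1-p₁
        nz = ℚ.pos⇒nonZero (1ℚ - p₁)
      ι = 1/ (1ℚ - p₁)
      0≤ι : 0ℚ ≤ ι
      0≤ι = ℚ.<⇒≤ (ℚ.positive⁻¹ ι {{ℚ.1/pos⇒pos (1ℚ - p₁)}})
      q = ι * (p - p₁)
      0≤p-p₁ : 0ℚ ≤ p - p₁
      0≤p-p₁ = ≤-trans (0≤* (0≤* 0≤4 0≤δ) 0≤κ) 4δκ≤p-p₁
      0≤q : 0ℚ ≤ q
      0≤q = 0≤* 0≤ι 0≤p-p₁
      q≤1 : q ≤ 1ℚ
      q≤1 = ≤-trans (*-monoˡ 0≤ι (ℚ.+-monoˡ-≤ (- p₁) p≤1)) (≤-reflexive (ℚ.*-inverseˡ (1ℚ - p₁)))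
      q≡ : (1ℚ - p₁) * q ≡ p - p₁
      q≡ = trans (≡.sym (ℚ.*-assoc (1ℚ - p₁) ι (p - p₁))) (trans (cong (_* (p - p₁)) (ℚ.*-inverseʳ (1ℚ - p₁))) (ℚ.*-identityˡ (p - p₁)))
      p≡ : p₁ + (1ℚ - p₁) * q ≡ p
      p≡ = trans (cong (p₁ +_) q≡) (solve 2 (λ a b → a :+ (b :- a) := b) refl p₁ p)
      p-p₁≤q : p - p₁ ≤ q
      p-p₁≤q = begin
        p - p₁           ≡⟨ q≡ ⟨
        (1ℚ - p₁) * q    ≤⟨ ≤-by-gap (p₁ * q) (0≤* 0≤p₁ 0≤q) (solve 2 (λ p q → q := (con 1ℚ :- p) :* q :+ p :* q) refl p₁ q) ⟩
        q                ∎

  -- q (δ² - p₁) L ≥ (4 δ κ) (δ² / 2) (K N / 2) = δ³ N = 2 μ N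
  gain : ∀ {q L N r} → four * δ * κ ≤ q → N * K ≤ two * L → 0ℚ ≤ L → 1ℚ - r ≡ δ →
    μ * N ≤ q * (L * ((1ℚ - r) * (1ℚ - r)) - p₁ * L) - μ * N
  gain {q} {L} {N} {r} 4δκ≤q NK≤2L 0≤L 1-r≡δ = begin
    μ * N
      ≡⟨ solve 2 (λ μ n → μ :* n := con two :* μ :* n :- μ :* n) refl μ N ⟩
    two * μ * N - μ * N
      ≡⟨ cong (λ t → two * t * N - μ * N) μ≡½δ³ ⟩
    two * (½ * (δ * δ * δ)) * N - μ * N
      ≡⟨ cong (_- μ * N) (ℚ.*-identityʳ (two * (½ * (δ * δ * δ)) * N)) ⟨
    two * (½ * (δ * δ * δ)) * N * 1ℚ - μ * N
      ≡⟨ cong (λ t → two * (½ * (δ * δ * δ)) * N * t - μ * N) κK≡1 ⟨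
    two * (½ * (δ * δ * δ)) * N * (κ * K) - μ * N
      ≡⟨ cong (_- μ * N) (solve 4 (λ δ n κ k → con two :* (con ½ :* (δ :* δ :* δ)) :* n :* (κ :* k) := con four :* δ :* κ :* (con ½ :* (δ :* δ) :* (con ½ :* (n :* k)))) refl δ N κ K) ⟩
    four * δ * κ * (½ * (δ * δ) * (½ * (N * K))) - μ * N
      ≤⟨ ℚ.+-monoˡ-≤ (- (μ * N)) (*-monoˡ 0≤4δκ (*-monoˡ (0≤* 0≤½ 0≤δ²) (*-monoˡ 0≤½ NK≤2L))) ⟩
    four * δ * κ * (½ * (δ * δ) * (½ * (two * L))) - μ * N
      ≤⟨ ℚ.+-monoˡ-≤ (- (μ * N)) (*-mono 0≤4δκ (0≤* (≤-trans (0≤* 0≤½ 0≤δ²) ½δ²≤δ²-p₁) 0≤L) 4δκ≤q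
           (≤-trans (≤-reflexive (cong (½ * (δ * δ) *_) (solve 1 (λ l → con ½ :* (con two :* l) := l) refl L))) (*-monoʳ 0≤L ½δ²≤δ²-p₁))) ⟩
    q * ((δ * δ - p₁) * L) - μ * N
      ≡⟨ cong (λ t → q * t - μ * N) (solve 3 (λ δ p l → (δ :* δ :- p) :* l := l :* (δ :* δ) :- p :* l) refl δ p₁ L) ⟩
    q * (L * (δ * δ) - p₁ * L) - μ * N
      ≡⟨ cong (λ t → q * (L * (t * t) - p₁ * L) - μ * N) 1-r≡δ ⟨
    q * (L * ((1ℚ - r) * (1ℚ - r)) - p₁ * L) - μ * N ∎
    where
    open ≤-Reasoning
    0≤4δκ : 0ℚ ≤ four * δ * κ
    0≤4δκ = 0≤* (0≤* 0≤4 0≤δ) 0≤κ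
    0≤δ² : 0ℚ ≤ δ * δ
    0≤δ² = 0≤* 0≤δ 0≤δ
    ½δ²≤δ²-p₁ : ½ * (δ * δ) ≤ δ * δ - p₁
    ½δ²≤δ²-p₁ = ≤-by-gap (½ * (δ * δ) - p₁) (≤⇒0≤- p₁≤½δ²)
      (solve 2 (λ δ p → δ :* δ :- p := con ½ :* (δ :* δ) :+ (con ½ :* (δ :* δ) :- p)) refl δ p₁)

theorem5p3 : ∀ (ε : ℚ) → 0ℚ < ε →
    ∃[ c ] (0ℚ < c × ∃[ k₀ ] (∀ (k : ℕ) → k₀ ℕ.≤ k →
    ∀ (n : ℕ) (G : Graph n) → MinDegreeAtLeast G k →
    ∀ (p : ℚ) → 0ℚ ≤ p → p ≤ 1ℚ → 1ℚ + ε ≤ p * ℕtoℚ k →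
    c * ℕtoℚ n ≤ expectedExc G p))
theorem5p3 ε 0<ε with ∃-unitFraction≤ ε 0<ε
-- `M * A ≤ k` gives `M/k ≤ δ`; the extra `suc` exposes `k` as a successor, so that `1/k` is a
-- `unitFraction`.
... | d , η≤ε = μ , 0<μ , suc (M ℕ.* A) , bound
  where
  open +-*-Solver
  A M : ℕ
  -- `A` is `1/δ`, where `8δ = 1 / suc d ≤ ε`. `M` is `2/δ³`: the gain `δ³ n` is then `2 μ n`, of
  -- which `μ n` pays for the big components and `μ n` remains.
  A = 8 ℕ.* suc d
  M = 2 ℕ.* (A ℕ.* A ℕ.* A)
  δ η μ a b : ℚ
  δ = unitFraction (ℕ.pred A)
  η = unitFraction d
  μ = ½ * (δ * δ * δ)
  a = ℕtoℚ A
  b = ℕtoℚ (suc d)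
  0<δ : 0ℚ < δ
  0<δ = 0<unitFraction (ℕ.pred A)
  0≤δ : 0ℚ ≤ δ
  0≤δ = ℚ.<⇒≤ 0<δ
  pos* : ∀ {x y} → 0ℚ < x → 0ℚ < y → 0ℚ < x * y
  pos* {x} {y} 0<x 0<y = ℚ.positive⁻¹ (x * y) {{ℚ.pos*pos⇒pos x {{positive 0<x}} y {{positive 0<y}}}}
  0<μ : 0ℚ < μ
  0<μ = pos* (ℚ.positive⁻¹ ½) (pos* (pos* 0<δ 0<δ) 0<δ)
  δa≡1 : δ * a ≡ 1ℚ
  δa≡1 = unitFraction-inverse (ℕ.pred A)
  8δ≡η : eight * δ ≡ η
  8δ≡η = begin
    eight * δ                  ≡⟨ ℚ.*-identityʳ (eight * δ) ⟨
    eight * δ * 1ℚ             ≡⟨ cong (eight * δ *_) (unitFraction-inverse d) ⟨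
    eight * δ * (η * b)        ≡⟨ solve 4 (λ e δ η b → e :* δ :* (η :* b) := δ :* (e :* b) :* η) refl eight δ η b ⟩
    δ * (eight * b) * η        ≡⟨ cong (λ t → δ * t * η) (ℕtoℚ-* 8 (suc d)) ⟨
    δ * a * η                  ≡⟨ cong (_* η) δa≡1 ⟩
    1ℚ * η                     ≡⟨ ℚ.*-identityˡ η ⟩
    η                          ∎
    where open ≡-Reasoning
  μM≡1 : μ * ℕtoℚ M ≡ 1ℚ
  μM≡1 = begin
    μ * ℕtoℚ M                       ≡⟨ cong (μ *_) (trans (ℕtoℚ-* 2 (A ℕ.* A ℕ.* A)) (cong (two *_) (trans (ℕtoℚ-* (A ℕ.* A) A) (cong (_* a) (ℕtoℚ-* A A))))) ⟩
    μ * (two * (a * a * a))          ≡⟨ solve 2 (λ δ a → con ½ :* (δ :* δ :* δ) :* (con two :* (a :* a :* a)) := δ :* a :* (δ :* a) :* (δ :* a)) refl δ a ⟩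
    δ * a * (δ * a) * (δ * a)        ≡⟨ cong (λ t → t * t * t) δa≡1 ⟩
    1ℚ                               ∎
    where open ≡-Reasoning
  bound : ∀ k → suc (M ℕ.* A) ℕ.≤ k → ∀ n (G : Graph n) → MinDegreeAtLeast G k →
    ∀ p → 0ℚ ≤ p → p ≤ 1ℚ → 1ℚ + ε ≤ p * ℕtoℚ k → μ * ℕtoℚ n ≤ expectedExc G p
  -- The hub needs a vertex, so the empty graph is treated apart; its expected excess computes to 0.
  bound k k₀≤k zero G deg≥ p 0≤p p≤1 pk≥ = ≤-reflexive (ℚ.*-zeroʳ μ)
  bound (suc k) (ℕ.s≤s MA≤k) (suc n) G deg≥ p 0≤p p≤1 pk≥ = conclude (second-round 8δ≤ε p≤1 pk≥)
    where
    κ K : ℚ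
    κ = unitFraction k
    K = ℕtoℚ (suc k)
    8δ≤ε : eight * δ ≤ ε
    8δ≤ε = ≤-trans (≤-reflexive 8δ≡η) η≤ε
    MA≤K : ℕtoℚ M * a ≤ K
    MA≤K = ≤-trans (≤-reflexive (≡.sym (ℕtoℚ-* M A))) (ℕtoℚ-mono {M ℕ.* A} {suc k} (ℕ.m≤n⇒m≤1+n MA≤k))
    open FirstRound {δ} {a} {κ} {K} {ℕtoℚ M} {μ} 0≤δ (≤-trans (≤-reflexive 8δ≡η) (unitFraction≤1 d)) (0≤unitFraction k)
      (unitFraction-inverse k) refl μM≡1 δa≡1 MA≤K
    M≤k : M ℕ.≤ suc k
    M≤k = ℕ.m≤n⇒m≤1+n (ℕ.≤-trans (ℕ.m≤m*n M A) MA≤k)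
    m = suc k ℕ.∸ M
    m+M≡k : m ℕ.+ M ≡ suc k
    m+M≡k = ℕ.m∸n+n≡m M≤k
    m≡ : ℕtoℚ m ≡ K - ℕtoℚ M
    m≡ = trans (solve 2 (λ m M → m := m :+ M :- M) refl (ℕtoℚ m) (ℕtoℚ M))
      (cong (_- ℕtoℚ M) (trans (≡.sym (ℕtoℚ-+ m M)) (cong ℕtoℚ m+M≡k)))
    L = ℕtoℚ (length (edges G))
    NK≤2L : ℕtoℚ (suc n) * K ≤ two * L
    NK≤2L = subst₂ _≤_ (ℕtoℚ-* (suc n) (suc k)) (ℕtoℚ-* 2 (length (edges G)))
      (ℕtoℚ-mono {suc n ℕ.* suc k} {2 ℕ.* length (edges G)} (handshake G deg≥))
    0≤1-δ : 0ℚ ≤ 1ℚ - δ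
    0≤1-δ = ≤⇒0≤- δ≤1
    1-δ≤1 : 1ℚ - δ ≤ 1ℚ
    1-δ≤1 = ≤-by-gap δ 0≤δ (solve 1 (λ δ → con 1ℚ := con 1ℚ :- δ :+ δ) refl δ)
    conclude : ∃[ q ] (p₁ + (1ℚ - p₁) * q ≡ p × 0ℚ ≤ q × q ≤ 1ℚ × four * δ * κ ≤ q) → μ * ℕtoℚ (suc n) ≤ expectedExc G p
    conclude (q , p≡ , 0≤q , q≤1 , 4δκ≤q) = subst (λ p → μ * ℕtoℚ (suc n) ≤ expectedExc G p) p≡
      (≤-trans (gain {q} {L} {ℕtoℚ (suc n)} {1ℚ - δ} 4δκ≤q NK≤2L (0≤ℕtoℚ (length (edges G))) (solve 1 (λ δ → con 1ℚ :- (con 1ℚ :- δ) := δ) refl δ))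
        (TwoRounds.expectedExc-bound zero G 0≤p₁ p₁≤1 0≤1-δ 1-δ≤1 {M} {m} {suc k} (ℕ.≤-reflexive m+M≡k) deg≥ (shrinks m m≡) {q} {μ} 0≤q q≤1 0≤μ μM≡1))
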